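{- Let $K$ be a number field of degree $n=[K:\mathbf{Q}]$. For $r\in\mathbf{Q}^*$, let $E_r$ be the elliptic curve $$E_r:\quad y^2=x\bigl(x^2-2(1-4r^4)x+(1+4r^4)^2\bigr).$$ Then for every $r\in\mathbf{Q}^*$, the adelic point group $E_r(\mathbf{A}_K)$ of $E_r$, viewed as an elliptic curve over $K$, is not isomorphic to the topological group $$\mathcal{E}_n=(\mathbf{R}/\mathbf{Z})^n\times\widehat{\mathbf{Z}}^n\times\prod_{m=1}^\infty \mathbf{Z}/m\mathbf{Z}.$$
   Context: Adelic point group: for an elliptic curve $E$ over a number field $K$, $E(\mathbf{A}_K)=\prod_{\mathfrak{p}\le\infty}E(K_\mathfrak{p})$, the product over all finite and infinite primes $\mathfrak{p}$ of $K$ of the point groups over the completions $K_\mathfrak{p}$, each with its natural ($\mathfrak{p}$-adic, real or complex) topology, and the product carrying the product topology. $\widehat{\mathbf{Z}}$ is the profinite completion of $\mathbf{Z}$; each $\mathbf{Z}/m\mathbf{Z}$ is discrete. Isomorphism means isomorphism of topological groups. -}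

module Defs where

open import Level using (0ℓ)
open import Data.Nat.Base as ℕ using (ℕ; suc)
import Data.Nat.Properties as ℕₚ
import Data.Nat.Divisibility as ℕ∣
open import Data.Integer.Base as ℤ using (ℤ)
import Data.Integer.Properties as ℤₚ
import Data.Integer.Divisibility.Signed as ℤ∣
open import Data.Rational.Base
open import Data.Rational.Properties
import Data.Rational.Unnormalised.Base as ℚᵘ
import Data.Rational.Unnormalised.Properties as ℚᵘₚ
open import Data.Rational.Solver using (module +-*-Solver)
open import Data.Fin.Base using (Fin)
open import Data.List.Base using (List)
open import Data.List.Relation.Unary.All using (All)
open import Data.Product.Base using (Σ; Σ-syntax; ∃-syntax; _×_; _,_; proj₁; proj₂)
open import Data.Sum.Base using (_⊎_; inj₁; inj₂)
open import Data.Empty using (⊥)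
open import Data.Unit.Base using (⊤; tt)
open import Function.Bundles using (Inverse; _⇔_)
open import Relation.Nullary.Negation using (¬_)
open import Relation.Binary.Bundles using (Setoid)
open import Relation.Binary.PropositionalEquality as ≡ using (_≡_; _≢_)
import Relation.Binary.Reasoning.Setoid as ≈-Reasoning
open import Algebra.Bundles using (CommutativeRing)
open import Algebra.Structures using (IsCommutativeRing)
open import Algebra.Apartness.Bundles using (HeytingField)
open import Algebra.Morphism.Structures using (module RingMorphisms)
import Algebra.Definitions.RawMonoid as RawMonoidDefinitions
import Algebra.Properties.Group as GroupProperties
import Algebra.Properties.Ring as RingProperties
import Algebra.Properties.CommutativeSemigroup as CommutativeSemigroupProperties

private
  half : ∀ {ε} → 0ℚ < ε → 0ℚ < ½ * ε
  half {ε} 0<ε = positive⁻¹ (½ * ε) {{pos*pos⇒pos ½ ε {{positive 0<ε}}}}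

  half+half : ∀ ε → ½ * ε + ½ * ε ≡ ε
  half+half ε = ≡.trans (≡.sym (*-distribʳ-+ ε ½ ½)) (*-identityˡ ε)

  half< : ∀ {ε} → 0ℚ < ε → ½ * ε < ε
  half< {ε} 0<ε = begin-strict
    ½ * ε          ≡⟨ +-identityʳ (½ * ε) ⟨
    ½ * ε + 0ℚ     <⟨ +-monoʳ-< (½ * ε) (half 0<ε) ⟩
    ½ * ε + ½ * ε  ≡⟨ half+half ε ⟩
    ε              ∎
    where open ≤-Reasoning

  divide : ∀ {B ε} → 0ℚ < B → 0ℚ < ε → ∃[ δ ] (0ℚ < δ × B * δ ≡ ε)
  divide {B} {ε} 0<B 0<ε = (1/ B) * ε , positive⁻¹ _ , (begin
      B * ((1/ B) * ε)  ≡⟨ *-assoc B (1/ B) ε ⟨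
      B * (1/ B) * ε    ≡⟨ ≡.cong (_* ε) (*-inverseʳ B) ⟩
      1ℚ * ε            ≡⟨ *-identityˡ ε ⟩
      ε                 ∎)
    where
    open ≡.≡-Reasoning
    instance
      B-pos = positive 0<B
      ε-pos = positive 0<ε
      B-nonZero = pos⇒nonZero B
      1/B-pos = 1/pos⇒pos B
      product-pos = pos*pos⇒pos (1/ B) ε

  *-mono-<-pos : ∀ {p q r s} → 0ℚ < p → 0ℚ < r → p < q → r < s → p * r < q * s
  *-mono-<-pos {p} {q} {r} {s} 0<p 0<r p<q r<s = <-trans
    (*-monoʳ-<-pos p {{positive 0<p}} r<s)
    (*-monoˡ-<-pos s {{positive (<-trans 0<r r<s)}} p<q)

Eventually : (ℕ → Set) → Set
Eventually P = ∃[ N ] (∀ n → N ℕ.≤ n → P n)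

private
  both : ∀ {P Q R : ℕ → Set} → (∀ n → P n → Q n → R n) →
         Eventually P → Eventually Q → Eventually R
  both f (M , p) (N , q) = M ℕ.⊔ N , λ n le →
    f n (p n (ℕₚ.≤-trans (ℕₚ.m≤m⊔n M N) le)) (q n (ℕₚ.≤-trans (ℕₚ.m≤n⊔m M N) le))

  each : ∀ {P Q : ℕ → Set} → (∀ n → P n → Q n) → Eventually P → Eventually Q
  each f (N , p) = N , λ n le → f n (p n le)

  always : ∀ {P : ℕ → Set} → (∀ n → P n) → Eventually P
  always p = 0 , λ n _ → p n

-- A commutative ring with a real-valued submultiplicative seminorm, of which
-- only the relation "∣ x ∣ is strictly less than the rational ε" is recorded.

record SeminormedRing : Set₁ where
  field
    commutativeRing : CommutativeRing 0ℓ 0ℓ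

  open CommutativeRing commutativeRing public
    using (Carrier; _≈_; 0#; 1#; -_; _-_; setoid; refl; sym)
    renaming (_+_ to _⊕_; _*_ to _⊛_; trans to ≈-trans; reflexive to ≈-reflexive)

  field
    ∣_∣<_     : Carrier → ℚ → Set
    ∣∣<-pos   : ∀ {x ε} → ∣ x ∣< ε → 0ℚ < ε
    ∣∣<-resp  : ∀ {x y ε} → x ≈ y → ∣ x ∣< ε → ∣ y ∣< ε
    ∣∣<-mono  : ∀ {x ε δ} → ε ≤ δ → ∣ x ∣< ε → ∣ x ∣< δ
    ∣∣<-zero  : ∀ {ε} → 0ℚ < ε → ∣ 0# ∣< ε
    ∣∣<-+     : ∀ {x y ε δ} → ∣ x ∣< ε → ∣ y ∣< δ → ∣ x ⊕ y ∣< (ε + δ)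
    ∣∣<-*     : ∀ {x y ε δ} → ∣ x ∣< ε → ∣ y ∣< δ → ∣ x ⊛ y ∣< (ε * δ)
    ∣∣<-bound : ∀ x → ∃[ B ] (∣ x ∣< B)

module CauchySequences (R : SeminormedRing) where

  private
    open module R = SeminormedRing R using (∣_∣<_)
    module A = CommutativeRing R.commutativeRing
    module P = RingProperties A.ring
    module S = CommutativeSemigroupProperties A.+-commutativeSemigroup

  IsCauchy : (ℕ → A.Carrier) → Set
  IsCauchy x = ∀ ε → 0ℚ < ε →
    ∃[ N ] (∀ m n → N ℕ.≤ m → N ℕ.≤ n → ∣ x m A.- x n ∣< ε)

  record Cauchy : Set where
    constructor cauchy
    field
      seq      : ℕ → A.Carrier
      isCauchy : IsCauchy seq

  open Cauchy public

  infix 4 _≈_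
  record _≈_ (x y : Cauchy) : Set where
    constructor null
    field
      isNull : ∀ ε → 0ℚ < ε → Eventually λ n → ∣ seq x n A.- seq y n ∣< ε

  open _≈_ public

  -- The limit of ∣ seq x n ∣ is less than ε.
  record ∥_∥<_ (x : Cauchy) (ε : ℚ) : Set where
    constructor bounded
    field
      bound           : ℚ
      bound<ε         : bound < ε
      eventuallyBelow : Eventually λ n → ∣ seq x n ∣< bound

  open ∥_∥<_ public

  private
    split : ∀ {x y z} → x A.≈ y A.+ z → ∀ {ε} → ∣ y ∣< (½ * ε) → ∣ z ∣< (½ * ε) → ∣ x ∣< ε
    split eq {ε} p q = R.∣∣<-mono (≤-reflexive (half+half ε)) (R.∣∣<-resp (A.sym eq) (R.∣∣<-+ p q))

    telescope : ∀ x y z → x A.- z A.≈ (x A.- y) A.+ (y A.- z)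
    telescope x y z = A.sym (begin
      (x A.- y) A.+ (y A.- z)          ≈⟨ A.+-assoc x (A.- y) (y A.- z) ⟩
      x A.+ (A.- y A.+ (y A.- z))      ≈⟨ A.+-congˡ (A.+-assoc (A.- y) y (A.- z)) ⟨
      x A.+ ((A.- y A.+ y) A.- z)      ≈⟨ A.+-congˡ (A.+-congʳ (A.-‿inverseˡ y)) ⟩
      x A.+ (A.0# A.- z)               ≈⟨ A.+-congˡ (A.+-identityˡ (A.- z)) ⟩
      x A.- z                          ∎)
      where open ≈-Reasoning A.setoid

    sum-difference : ∀ x y x′ y′ →
      (x A.+ y) A.- (x′ A.+ y′) A.≈ (x A.- x′) A.+ (y A.- y′)
    sum-difference x y x′ y′ = begin
      (x A.+ y) A.- (x′ A.+ y′)            ≈⟨ A.+-congˡ (P.-‿+-comm x′ y′) ⟨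
      (x A.+ y) A.+ (A.- x′ A.+ A.- y′)    ≈⟨ S.interchange x y (A.- x′) (A.- y′) ⟩
      (x A.- x′) A.+ (y A.- y′)            ∎
      where open ≈-Reasoning A.setoid

    product-difference : ∀ x y x′ y′ →
      (x A.* y) A.- (x′ A.* y′) A.≈ (x A.* (y A.- y′)) A.+ ((x A.- x′) A.* y′)
    product-difference x y x′ y′ = begin
      (x A.* y) A.- (x′ A.* y′)
        ≈⟨ telescope (x A.* y) (x A.* y′) (x′ A.* y′) ⟩
      ((x A.* y) A.- (x A.* y′)) A.+ ((x A.* y′) A.- (x′ A.* y′))
        ≈⟨ A.+-cong (P.x[y-z]≈xy-xz x y y′) (P.[y-z]x≈yx-zx y′ x x′) ⟨
      (x A.* (y A.- y′)) A.+ ((x A.- x′) A.* y′) ∎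
      where open ≈-Reasoning A.setoid

    negative-difference : ∀ x y → (A.- x) A.- (A.- y) A.≈ y A.- x
    negative-difference x y =
      A.trans (A.+-congˡ (P.-‿involutive y)) (A.+-comm (A.- x) y)

    recover : ∀ u v → (u A.- v) A.+ v A.≈ u
    recover u v = A.trans (A.+-assoc u (A.- v) v)
      (A.trans (A.+-congˡ (A.-‿inverseˡ v)) (A.+-identityʳ u))

    swap-difference : ∀ x y → y A.- x A.≈ (A.- A.1#) A.* (x A.- y)
    swap-difference x y = A.sym (A.trans (P.-1*x≈-x (x A.- y)) (begin
      A.- (x A.- y)          ≈⟨ P.-‿+-comm x (A.- y) ⟨
      A.- x A.+ A.- (A.- y)  ≈⟨ negative-difference x y ⟩
      y A.- x                ∎))
      where open ≈-Reasoning A.setoid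

    ≈-refl : ∀ {x} → x ≈ x
    ≈-refl {x} = null λ ε 0<ε → always λ n →
      R.∣∣<-resp (A.sym (A.-‿inverseʳ (seq x n))) (R.∣∣<-zero 0<ε)

    ≈-sym : ∀ {x y} → x ≈ y → y ≈ x
    ≈-sym {x} {y} eq .isNull ε 0<ε with R.∣∣<-bound (A.- A.1#)
    ... | B , b with divide (R.∣∣<-pos b) 0<ε
    ... | δ , 0<δ , Bδ≡ε = each
      (λ n s → R.∣∣<-resp (A.sym (swap-difference (seq x n) (seq y n)))
                 (R.∣∣<-mono (≤-reflexive Bδ≡ε) (R.∣∣<-* b s)))
      (isNull eq δ 0<δ)

    ≈-trans : ∀ {x y z} → x ≈ y → y ≈ z → x ≈ z
    ≈-trans {x} {y} {z} p q .isNull ε 0<ε = both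
      (λ n → split (telescope (seq x n) (seq y n) (seq z n)))
      (isNull p (½ * ε) (half 0<ε)) (isNull q (½ * ε) (half 0<ε))

    eventually-bounded : ∀ x → ∃[ B ] Eventually λ n → ∣ seq x n ∣< B
    eventually-bounded x with isCauchy x 1ℚ (positive⁻¹ 1ℚ)
    ... | N , close with R.∣∣<-bound (seq x N)
    ... | B , b = 1ℚ + B , N , λ n N≤n →
      R.∣∣<-resp (recover (seq x n) (seq x N)) (R.∣∣<-+ (close n N N≤n ℕₚ.≤-refl) b)

    bound-pos : ∀ {x : ℕ → A.Carrier} {B} → Eventually (λ n → ∣ x n ∣< B) → 0ℚ < B
    bound-pos (N , b) = R.∣∣<-pos (b N ℕₚ.≤-refl)

    factorˡ : ∀ {x y ε B δ} → B * δ ≡ ε → ∣ x ∣< B → ∣ y ∣< δ → ∣ x A.* y ∣< ε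
    factorˡ eq p q = R.∣∣<-mono (≤-reflexive eq) (R.∣∣<-* p q)

    factorʳ : ∀ {x y ε B δ} → B * δ ≡ ε → ∣ x ∣< δ → ∣ y ∣< B → ∣ x A.* y ∣< ε
    factorʳ {B = B} {δ} eq p q =
      R.∣∣<-mono (≤-reflexive (≡.trans (*-comm δ B) eq)) (R.∣∣<-* p q)

  pointwise : ∀ {x y} → (∀ n → seq x n A.≈ seq y n) → x ≈ y
  pointwise {x} {y} eq = null λ ε 0<ε → always λ n →
    R.∣∣<-resp (A.sym (A.trans (A.+-congʳ (eq n)) (A.-‿inverseʳ (seq y n)))) (R.∣∣<-zero 0<ε)

  -- Proofs are abstract only to keep normal forms small.
  private abstract
    constant-isCauchy : ∀ a → IsCauchy λ _ → a
    constant-isCauchy a ε 0<ε = 0 , λ _ _ _ _ →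
      R.∣∣<-resp (A.sym (A.-‿inverseʳ a)) (R.∣∣<-zero 0<ε)

    +-isCauchy : ∀ x y → IsCauchy λ n → seq x n A.+ seq y n
    +-isCauchy x y ε 0<ε =
      let M , p = isCauchy x (½ * ε) (half 0<ε)
          N , q = isCauchy y (½ * ε) (half 0<ε)
      in M ℕ.⊔ N , λ m n le le′ → split (sum-difference (seq x m) (seq y m) (seq x n) (seq y n))
        (p m n (ℕₚ.≤-trans (ℕₚ.m≤m⊔n M N) le) (ℕₚ.≤-trans (ℕₚ.m≤m⊔n M N) le′))
        (q m n (ℕₚ.≤-trans (ℕₚ.m≤n⊔m M N) le) (ℕₚ.≤-trans (ℕₚ.m≤n⊔m M N) le′))

    neg-isCauchy : ∀ x → IsCauchy λ n → A.- seq x n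
    neg-isCauchy x ε 0<ε =
      let N , p = isCauchy x ε 0<ε
      in N , λ m n le le′ →
        R.∣∣<-resp (A.sym (negative-difference (seq x m) (seq x n))) (p n m le′ le)

    *-isCauchy : ∀ x y → IsCauchy λ n → seq x n A.* seq y n
    *-isCauchy x y ε 0<ε with eventually-bounded x | eventually-bounded y
    ... | B , K , b | C , L , c
      with divide (bound-pos {seq x} (K , b)) (half 0<ε)
         | divide (bound-pos {seq y} (L , c)) (half 0<ε)
    ... | δ , 0<δ , Bδ | η , 0<η , Cη
      with isCauchy y δ 0<δ | isCauchy x η 0<η
    ... | M , p | N , q = (K ℕ.⊔ L) ℕ.⊔ (M ℕ.⊔ N) , λ m n le le′ →
      split (product-difference (seq x m) (seq y m) (seq x n) (seq y n))
        (factorˡ Bδ (b m (≤K le)) (p m n (≤M le) (≤M le′)))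
        (factorʳ Cη (q m n (≤N le) (≤N le′)) (c n (≤L le′)))
      where
      ≤K : ∀ {n} → (K ℕ.⊔ L) ℕ.⊔ (M ℕ.⊔ N) ℕ.≤ n → K ℕ.≤ n
      ≤K le = ℕₚ.≤-trans (ℕₚ.m≤m⊔n K L) (ℕₚ.≤-trans (ℕₚ.m≤m⊔n (K ℕ.⊔ L) (M ℕ.⊔ N)) le)
      ≤L : ∀ {n} → (K ℕ.⊔ L) ℕ.⊔ (M ℕ.⊔ N) ℕ.≤ n → L ℕ.≤ n
      ≤L le = ℕₚ.≤-trans (ℕₚ.m≤n⊔m K L) (ℕₚ.≤-trans (ℕₚ.m≤m⊔n (K ℕ.⊔ L) (M ℕ.⊔ N)) le)
      ≤M : ∀ {n} → (K ℕ.⊔ L) ℕ.⊔ (M ℕ.⊔ N) ℕ.≤ n → M ℕ.≤ n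
      ≤M le = ℕₚ.≤-trans (ℕₚ.m≤m⊔n M N) (ℕₚ.≤-trans (ℕₚ.m≤n⊔m (K ℕ.⊔ L) (M ℕ.⊔ N)) le)
      ≤N : ∀ {n} → (K ℕ.⊔ L) ℕ.⊔ (M ℕ.⊔ N) ℕ.≤ n → N ℕ.≤ n
      ≤N le = ℕₚ.≤-trans (ℕₚ.m≤n⊔m M N) (ℕₚ.≤-trans (ℕₚ.m≤n⊔m (K ℕ.⊔ L) (M ℕ.⊔ N)) le)

  constant : A.Carrier → Cauchy
  constant a = cauchy (λ _ → a) (constant-isCauchy a)

  infixl 6 _+ᶜ_
  infixl 7 _*ᶜ_

  _+ᶜ_ : Cauchy → Cauchy → Cauchy
  x +ᶜ y = cauchy (λ n → seq x n A.+ seq y n) (+-isCauchy x y)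

  -ᶜ_ : Cauchy → Cauchy
  -ᶜ x = cauchy (λ n → A.- seq x n) (neg-isCauchy x)

  _*ᶜ_ : Cauchy → Cauchy → Cauchy
  x *ᶜ y = cauchy (λ n → seq x n A.* seq y n) (*-isCauchy x y)

  private
    +-cong : ∀ {x x′ y y′} → x ≈ x′ → y ≈ y′ → x +ᶜ y ≈ x′ +ᶜ y′
    +-cong {x} {x′} {y} {y′} p q .isNull ε 0<ε = both
      (λ n → split (sum-difference (seq x n) (seq y n) (seq x′ n) (seq y′ n)))
      (isNull p (½ * ε) (half 0<ε)) (isNull q (½ * ε) (half 0<ε))

    -ᶜ-cong : ∀ {x y} → x ≈ y → -ᶜ x ≈ -ᶜ y
    -ᶜ-cong {x} {y} p .isNull ε 0<ε = each
      (λ n → R.∣∣<-resp (A.sym (negative-difference (seq x n) (seq y n))))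
      (isNull (≈-sym p) ε 0<ε)

    *-cong : ∀ {x x′ y y′} → x ≈ x′ → y ≈ y′ → x *ᶜ y ≈ x′ *ᶜ y′
    *-cong {x} {x′} {y} {y′} p q .isNull ε 0<ε with eventually-bounded x | eventually-bounded y′
    ... | B , b | C , c
      with divide (bound-pos {seq x} b) (half 0<ε) | divide (bound-pos {seq y′} c) (half 0<ε)
    ... | δ , 0<δ , Bδ | η , 0<η , Cη = both
      (λ n → split (product-difference (seq x n) (seq y n) (seq x′ n) (seq y′ n)))
      (both (λ n → factorˡ Bδ) b (isNull q δ 0<δ))
      (both (λ n → factorʳ Cη) (isNull p η 0<η) c)

  private abstract
    isCommutativeRing : IsCommutativeRing _≈_ _+ᶜ_ _*ᶜ_ -ᶜ_ (constant A.0#) (constant A.1#)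
    isCommutativeRing = record
      { isRing = record
        { +-isAbelianGroup = record
          { isGroup = record
            { isMonoid = record
              { isSemigroup = record
                { isMagma = record
                  { isEquivalence = record
                    { refl = ≈-refl ; sym = ≈-sym ; trans = ≈-trans }
                  ; ∙-cong = +-cong }
                ; assoc = λ x y z → pointwise λ n → A.+-assoc (seq x n) (seq y n) (seq z n) }
              ; identity = (λ x → pointwise λ n → A.+-identityˡ (seq x n))
                         , (λ x → pointwise λ n → A.+-identityʳ (seq x n)) }
            ; inverse = (λ x → pointwise λ n → A.-‿inverseˡ (seq x n))
                      , (λ x → pointwise λ n → A.-‿inverseʳ (seq x n))
            ; ⁻¹-cong = -ᶜ-cong }
          ; comm = λ x y → pointwise λ n → A.+-comm (seq x n) (seq y n) }
        ; *-cong = *-cong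
        ; *-assoc = λ x y z → pointwise λ n → A.*-assoc (seq x n) (seq y n) (seq z n)
        ; *-identity = (λ x → pointwise λ n → A.*-identityˡ (seq x n))
                     , (λ x → pointwise λ n → A.*-identityʳ (seq x n))
        ; distrib = (λ x y z → pointwise λ n → A.distribˡ (seq x n) (seq y n) (seq z n))
                  , (λ x y z → pointwise λ n → A.distribʳ (seq x n) (seq y n) (seq z n)) }
      ; *-comm = λ x y → pointwise λ n → A.*-comm (seq x n) (seq y n) }

  completionRing : CommutativeRing 0ℓ 0ℓ
  completionRing = record
    { Carrier = Cauchy ; _≈_ = _≈_ ; _+_ = _+ᶜ_ ; _*_ = _*ᶜ_ ; -_ = -ᶜ_
    ; 0# = constant A.0# ; 1# = constant A.1#
    ; isCommutativeRing = isCommutativeRing }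

  private
    ∥∥-resp : ∀ {x y ε} → x ≈ y → ∥ x ∥< ε → ∥ y ∥< ε
    ∥∥-resp {x} {y} {ε} eq (bounded δ δ<ε b) with <-dense δ<ε
    ... | μ , δ<μ , μ<ε = bounded μ μ<ε (both
      (λ n p q → R.∣∣<-mono (≤-reflexive sum≡) (R.∣∣<-resp (recover (seq y n) (seq x n)) (R.∣∣<-+ q p)))
      b (isNull (≈-sym eq) (μ - δ) 0<μ-δ))
      where
      sum≡ : (μ - δ) + δ ≡ μ
      sum≡ = solve 2 (λ m d → (m :- d) :+ d := m) ≡.refl μ δ
        where open +-*-Solver
      0<μ-δ : 0ℚ < μ - δ
      0<μ-δ = ≡.subst (_< μ - δ) (+-inverseʳ δ) (+-monoˡ-< (- δ) δ<μ)

  completion : SeminormedRing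
  completion = record
    { commutativeRing = completionRing
    ; ∣_∣<_ = ∥_∥<_
    ; ∣∣<-pos = λ { {x} (bounded δ δ<ε b) → <-trans (bound-pos {seq x} b) δ<ε }
    ; ∣∣<-resp = ∥∥-resp
    ; ∣∣<-mono = λ { ε≤δ (bounded μ μ<ε b) → bounded μ (<-≤-trans μ<ε ε≤δ) b }
    ; ∣∣<-zero = λ {ε} 0<ε → bounded (½ * ε) (half< 0<ε) (always λ _ → R.∣∣<-zero (half 0<ε))
    ; ∣∣<-+ = λ { (bounded δ δ< b) (bounded η η< c) →
        bounded (δ + η) (+-mono-< δ< η<) (both (λ _ → R.∣∣<-+) b c) }
    ; ∣∣<-* = λ { {x} {y} (bounded δ δ< b) (bounded η η< c) →
        bounded (δ * η) (*-mono-<-pos (bound-pos {seq x} b) (bound-pos {seq y} c) δ< η<)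
          (both (λ _ → R.∣∣<-*) b c) }
    ; ∣∣<-bound = λ x → let B , b = eventually-bounded x in B + 1ℚ , bounded B
        (≡.subst (_< B + 1ℚ) (+-identityʳ B) (+-monoʳ-< B (positive⁻¹ 1ℚ))) b
    }

private abstract
  ℚ-isCommutativeRing : IsCommutativeRing _≡_ _+_ _*_ -_ 0ℚ 1ℚ
  ℚ-isCommutativeRing = +-*-isCommutativeRing

ℚ-seminormed : SeminormedRing
ℚ-seminormed = record
  { commutativeRing = record { isCommutativeRing = ℚ-isCommutativeRing }
  ; ∣_∣<_     = λ x ε → ∣ x ∣ < ε
  ; ∣∣<-pos   = λ {x} b → ≤-<-trans (0≤∣p∣ x) b
  ; ∣∣<-resp  = λ { ≡.refl b → b }
  ; ∣∣<-mono  = λ le b → <-≤-trans b le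
  ; ∣∣<-zero  = λ 0<ε → 0<ε
  ; ∣∣<-+     = λ {x} {y} b c → ≤-<-trans (∣p+q∣≤∣p∣+∣q∣ x y) (+-mono-< b c)
  ; ∣∣<-*     = λ {x} {y} {ε} {δ} b c → product x y ε δ b c
  ; ∣∣<-bound = λ x → ∣ x ∣ + 1ℚ , ≡.subst (_< ∣ x ∣ + 1ℚ) (+-identityʳ ∣ x ∣)
                                     (+-monoʳ-< ∣ x ∣ (positive⁻¹ 1ℚ))
  }
  where
  product : ∀ x y ε δ → ∣ x ∣ < ε → ∣ y ∣ < δ → ∣ x * y ∣ < ε * δ
  product x y ε δ b c = begin-strict
    ∣ x * y ∣      ≡⟨ ∣p*q∣≡∣p∣*∣q∣ x y ⟩
    ∣ x ∣ * ∣ y ∣  ≤⟨ *-monoˡ-≤-nonNeg ∣ x ∣ {{nonNegative (0≤∣p∣ x)}} (<⇒≤ c) ⟩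
    ∣ x ∣ * δ      <⟨ *-monoˡ-<-pos δ {{positive (≤-<-trans (0≤∣p∣ y) c)}} b ⟩
    ε * δ          ∎
    where open ≤-Reasoning

module ℝ where
  open CauchySequences ℚ-seminormed public
    renaming (Cauchy to ℝ; constant to fromℚ; _+ᶜ_ to _+ʳ_; _*ᶜ_ to _*ʳ_; -ᶜ_ to -ʳ_)

  infix 4 _≤ʳ_ _<ʳ_

  _≤ʳ_ : ℝ → ℝ → Set
  x ≤ʳ y = ∀ ε → 0ℚ < ε → Eventually λ n → seq x n ≤ seq y n + ε

  _<ʳ_ : ℝ → ℝ → Set
  x <ʳ y = ∃[ ε ] (0ℚ < ε × Eventually λ n → seq x n + ε ≤ seq y n)

  ∥∥-mono : ∀ {x y ε} → fromℚ 0ℚ ≤ʳ x → x ≤ʳ y → ∥ y ∥< ε → ∥ x ∥< ε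
  ∥∥-mono {x} {y} {ε} 0≤x x≤y (bounded δ δ<ε b) with <-dense δ<ε
  ... | μ , δ<μ , μ<ε = bounded μ μ<ε
      (both (λ n → below) b (both (λ n → _,_) (0≤x (μ - δ) 0<μ-δ) (x≤y (μ - δ) 0<μ-δ)))
    where
    open ≤-Reasoning
    0<μ-δ : 0ℚ < μ - δ
    0<μ-δ = ≡.subst (_< μ - δ) (+-inverseʳ δ) (+-monoˡ-< (- δ) δ<μ)
    p≤∣p∣ : ∀ p → p ≤ ∣ p ∣
    p≤∣p∣ p with ≤-total 0ℚ p
    ... | inj₁ 0≤p = ≤-reflexive (≡.sym (0≤p⇒∣p∣≡p 0≤p))
    ... | inj₂ p≤0 = ≤-trans p≤0 (0≤∣p∣ p)
    below : ∀ {p q} → ∣ q ∣ < δ → 0ℚ ≤ p + (μ - δ) × p ≤ q + (μ - δ) → ∣ p ∣ < μ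
    below {p} {q} ∣q∣<δ (lower , upper) with ∣p∣≡p∨∣p∣≡-p p
    ... | inj₁ eq = begin-strict
      ∣ p ∣          ≡⟨ eq ⟩
      p              ≤⟨ upper ⟩
      q + (μ - δ)    <⟨ +-monoˡ-< (μ - δ) (≤-<-trans (p≤∣p∣ q) ∣q∣<δ) ⟩
      δ + (μ - δ)    ≡⟨ solve 2 (λ d m → d :+ (m :- d) := m) ≡.refl δ μ ⟩
      μ              ∎
      where open +-*-Solver
    ... | inj₂ eq = begin-strict
      ∣ p ∣                  ≡⟨ eq ⟩
      - p                    ≡⟨ +-identityʳ (- p) ⟨
      - p + 0ℚ               ≤⟨ +-monoʳ-≤ (- p) lower ⟩
      - p + (p + (μ - δ))    ≡⟨ solve 2 (λ a e → :- a :+ (a :+ e) := e) ≡.refl p (μ - δ) ⟩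
      μ - δ                  <⟨ +-monoʳ-< μ (neg-antimono-< (≤-<-trans (0≤∣p∣ q) ∣q∣<δ)) ⟩
      μ - 0ℚ                 ≡⟨ +-identityʳ μ ⟩
      μ                      ∎
      where open +-*-Solver

open ℝ using (ℝ; fromℚ)

record NumberField (n : ℕ) : Set₁ where
  field
    underlyingField : HeytingField 0ℓ 0ℓ 0ℓ

  open HeytingField underlyingField public
    using (Carrier; _≈_; _#_; 0#; 1#; heytingCommutativeRing)
    renaming (_+_ to _⊕_; _*_ to _⊛_)

  commutativeRing : CommutativeRing 0ℓ 0ℓ
  commutativeRing = record { isCommutativeRing = HeytingField.isCommutativeRing underlyingField }

  open RingMorphisms +-*-rawRing (CommutativeRing.rawRing commutativeRing)
    using (IsRingHomomorphism)
  open RawMonoidDefinitions (CommutativeRing.+-rawMonoid commutativeRing) using (sum)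

  field
    ι                  : ℚ → Carrier
    isRingHomomorphism : IsRingHomomorphism ι
    basis              : Fin n → Carrier

  combination : (Fin n → ℚ) → Carrier
  combination q = sum λ i → ι (q i) ⊛ basis i

  field
    spanning    : ∀ x → ∃[ q ] (x ≈ combination q)
    independent : ∀ q → combination q ≈ 0# → ∀ i → q i ≡ 0ℚ

-- A prime of K, finite or infinite, is an equivalence class of nontrivial
-- absolute values on K; equivalence is _∼_ below.

record AbsoluteValue {d} (K : NumberField d) : Set where
  open NumberField K
  field
    ∣_∣ᵥ       : Carrier → ℝ
    cong       : ∀ {x y} → x ≈ y → ∣ x ∣ᵥ ℝ.≈ ∣ y ∣ᵥ
    nonneg     : ∀ x → fromℚ 0ℚ ℝ.≤ʳ ∣ x ∣ᵥ
    zero       : ∣ 0# ∣ᵥ ℝ.≈ fromℚ 0ℚ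
    positivity : ∀ {x} → x # 0# → fromℚ 0ℚ ℝ.<ʳ ∣ x ∣ᵥ
    mult       : ∀ x y → ∣ x ⊛ y ∣ᵥ ℝ.≈ ∣ x ∣ᵥ ℝ.*ʳ ∣ y ∣ᵥ
    triangle   : ∀ x y → ∣ x ⊕ y ∣ᵥ ℝ.≤ʳ ∣ x ∣ᵥ ℝ.+ʳ ∣ y ∣ᵥ
    nontrivial : ∃[ x ] (x # 0# × ¬ (∣ x ∣ᵥ ℝ.≈ fromℚ 1ℚ))

module _ {d} {K : NumberField d} (v : AbsoluteValue K) where
  open NumberField K
  open AbsoluteValue v

  seminormed : SeminormedRing
  seminormed = record
    { commutativeRing = commutativeRing
    ; ∣_∣<_     = λ x ε → ℝ.∥ ∣ x ∣ᵥ ∥< ε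
    ; ∣∣<-pos   = C.∣∣<-pos
    ; ∣∣<-resp  = λ eq → C.∣∣<-resp (cong eq)
    ; ∣∣<-mono  = C.∣∣<-mono
    ; ∣∣<-zero  = λ 0<ε → C.∣∣<-resp (C.sym zero) (C.∣∣<-zero 0<ε)
    ; ∣∣<-+     = λ {x} {y} b c → ℝ.∥∥-mono (nonneg (x ⊕ y)) (triangle x y) (C.∣∣<-+ b c)
    ; ∣∣<-*     = λ {x} {y} b c → C.∣∣<-resp (C.sym (mult x y)) (C.∣∣<-* b c)
    ; ∣∣<-bound = λ x → C.∣∣<-bound ∣ x ∣ᵥ
    }
    where module C = SeminormedRing ℝ.completion

module _ {d} {K : NumberField d} where
  -- The topology defined by w is finer than the one defined by v.
  _≼_ : AbsoluteValue K → AbsoluteValue K → Set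
  v ≼ w = ∀ ε → 0ℚ < ε → ∃[ δ ] (0ℚ < δ ×
            (∀ x → SeminormedRing.∣_∣<_ (seminormed w) x δ → SeminormedRing.∣_∣<_ (seminormed v) x ε))

  -- Equivalent absolute values are those defining the same topology on K.
  _∼_ : AbsoluteValue K → AbsoluteValue K → Set
  v ∼ w = v ≼ w × w ≼ v

  completionAt : AbsoluteValue K → SeminormedRing
  completionAt v = CauchySequences.completion (seminormed v)

  module _ (v : AbsoluteValue K) where
    open CauchySequences (seminormed v) using (constant)
    fromBase : NumberField.Carrier K → SeminormedRing.Carrier (completionAt v)
    fromBase = constant

  -- The isomorphism of completions that is the identity on K.
  transfer : (v w : AbsoluteValue K) → v ∼ w →
             SeminormedRing.Carrier (completionAt v) → SeminormedRing.Carrier (completionAt w)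
  transfer v w (_ , w≼v) x = cauchy (seq x) λ ε 0<ε →
    let δ , 0<δ , f = w≼v ε 0<ε
        N , p       = isCauchy x δ 0<δ
    in N , λ m n le le′ → f _ (p m n le le′)
    where
    open CauchySequences (seminormed v) using (seq; isCauchy)
    open CauchySequences (seminormed w) using (cauchy)

-- The data of a topological group, without its laws: a setoid, the graph of the
-- group operation (x ∙ y ↦ z says that z is the product of x and y), and a base
-- of neighbourhoods at every point. The operation is given by its graph
-- because the chord and tangent law is defined by cases on equalities of
-- coordinates, which are not decidable in a completion.

record RawTopologicalGroup : Set₁ where
  field
    setoid : Setoid 0ℓ 0ℓ
  open Setoid setoid public using (Carrier; _≈_)
  field
    _∙_↦_ : Carrier → Carrier → Carrier → Set
    Nbhd  : Carrier → Set
    _∋_   : ∀ {x} → Nbhd x → Carrier → Set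

open RawTopologicalGroup using (Carrier; Nbhd)

record _≅_ (G H : RawTopologicalGroup) : Set where
  private
    module G = RawTopologicalGroup G
    module H = RawTopologicalGroup H
  field
    inverse : Inverse G.setoid H.setoid
  open Inverse inverse public using (to; from)
  field
    -- For graphs of group operations and a bijection, preserving the graph is
    -- equivalent to preserving and reflecting it.
    homo            : ∀ x y z → x G.∙ y ↦ z ⇔ to x H.∙ to y ↦ to z
    to-continuous   : ∀ x (V : H.Nbhd (to x)) →
                      Σ[ U ∈ G.Nbhd x ] (∀ y → U G.∋ y → V H.∋ to y)
    from-continuous : ∀ x (V : G.Nbhd (from x)) →
                      Σ[ U ∈ H.Nbhd x ] (∀ y → U H.∋ y → V G.∋ from y)

infix 4 _≅_

∏ : (I : Set) → (I → RawTopologicalGroup) → RawTopologicalGroup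
∏ I G = record
  { setoid = record
    { Carrier = ∀ i → Carrier (G i)
    ; _≈_ = λ x y → ∀ i → G.setoid i .Setoid._≈_ (x i) (y i)
    ; isEquivalence = record
      { refl  = λ i → Setoid.refl (G.setoid i)
      ; sym   = λ p i → Setoid.sym (G.setoid i) (p i)
      ; trans = λ p q i → Setoid.trans (G.setoid i) (p i) (q i) } }
  ; _∙_↦_ = λ x y z → ∀ i → G._∙_↦_ i (x i) (y i) (z i)
  ; Nbhd = λ x → List (Σ[ i ∈ I ] Nbhd (G i) (x i))
  ; _∋_ = λ Us y → All (λ { (i , U) → G._∋_ i U (y i) }) Us }
  where module G i = RawTopologicalGroup (G i)

infixr 5 _⊗_

_⊗_ : RawTopologicalGroup → RawTopologicalGroup → RawTopologicalGroup
G ⊗ H = record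
  { setoid = record
    { Carrier = G.Carrier × H.Carrier
    ; _≈_ = λ { (x , x′) (y , y′) → x G.≈ y × x′ H.≈ y′ }
    ; isEquivalence = record
      { refl  = Setoid.refl G.setoid , Setoid.refl H.setoid
      ; sym   = λ { (p , p′) → Setoid.sym G.setoid p , Setoid.sym H.setoid p′ }
      ; trans = λ { (p , p′) (q , q′) → Setoid.trans G.setoid p q , Setoid.trans H.setoid p′ q′ } } }
  ; _∙_↦_ = λ { (x , x′) (y , y′) (z , z′) → x G.∙ y ↦ z × x′ H.∙ y′ ↦ z′ }
  ; Nbhd = λ { (x , x′) → G.Nbhd x × H.Nbhd x′ }
  ; _∋_ = λ { (U , U′) (y , y′) → U G.∋ y × U′ H.∋ y′ } }
  where
  module G = RawTopologicalGroup G
  module H = RawTopologicalGroup H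

subgroup : (G : RawTopologicalGroup) → (Carrier G → Set) → RawTopologicalGroup
subgroup G P = record
  { setoid = record
    { Carrier = Σ G.Carrier P
    ; _≈_ = λ x y → proj₁ x G.≈ proj₁ y
    ; isEquivalence = record
      { refl  = Setoid.refl G.setoid
      ; sym   = Setoid.sym G.setoid
      ; trans = Setoid.trans G.setoid } }
  ; _∙_↦_ = λ x y z → proj₁ x G.∙ proj₁ y ↦ proj₁ z
  ; Nbhd = λ x → G.Nbhd (proj₁ x)
  ; _∋_ = λ U y → U G.∋ proj₁ y }
  where module G = RawTopologicalGroup G

Radius : Set
Radius = Σ[ ε ∈ ℚ ] 0ℚ < ε

private
  toℚᵘ-/1 : ∀ k → toℚᵘ (k / 1) ℚᵘ.≃ ℚᵘ.mkℚᵘ k 0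
  toℚᵘ-/1 k = toℚᵘ-fromℚᵘ (ℚᵘ.mkℚᵘ k 0)

  neg-/1 : ∀ k → (ℤ.- k) / 1 ≡ - (k / 1)
  neg-/1 k = toℚᵘ-injective (ℚᵘₚ.≃-trans (toℚᵘ-/1 (ℤ.- k))
    (ℚᵘₚ.≃-sym (ℚᵘₚ.≃-trans (toℚᵘ-homo‿- (k / 1)) (ℚᵘₚ.-‿cong (toℚᵘ-/1 k)))))

  +-/1 : ∀ k l → (k ℤ.+ l) / 1 ≡ k / 1 + l / 1
  +-/1 k l = toℚᵘ-injective (ℚᵘₚ.≃-trans (toℚᵘ-/1 (k ℤ.+ l))
    (ℚᵘₚ.≃-sym (ℚᵘₚ.≃-trans (toℚᵘ-homo-+ (k / 1) (l / 1))
      (ℚᵘₚ.≃-trans (ℚᵘₚ.+-cong (toℚᵘ-/1 k) (toℚᵘ-/1 l))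
        (ℚᵘ.*≡* (≡.cong (ℤ._* (ℤ.+ 1)) (≡.cong₂ ℤ._+_ (ℤₚ.*-identityʳ k) (ℤₚ.*-identityʳ l))))))))

ℤ/_ : ℕ → RawTopologicalGroup
ℤ/ m = record
  { setoid = record
    { Carrier = ℤ
    ; _≈_ = _≡ₘ_
    ; isEquivalence = record
      { refl  = λ {a} → ≡.subst (ℤ.+ m ℤ∣.∣_) (≡.sym (ℤₚ.+-inverseʳ a)) (ℤ∣.divides ℤ.0ℤ ≡.refl)
      ; sym   = λ {a} {b} p → ≡.subst (ℤ.+ m ℤ∣.∣_) (neg-difference a b) (ℤ∣.∣m⇒∣-m p)
      ; trans = λ {a} {b} {c} p q →
          ≡.subst (ℤ.+ m ℤ∣.∣_) (ℤₚ.+-minus-telescope a b c) (ℤ∣.∣m∣n⇒∣m+n p q) } }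
  ; _∙_↦_ = λ a b c → (a ℤ.+ b) ≡ₘ c
  ; Nbhd = λ _ → ⊤
  ; _∋_ = λ {a} _ b → a ≡ₘ b }
  where
  _≡ₘ_ : ℤ → ℤ → Set
  a ≡ₘ b = ℤ.+ m ℤ∣.∣ (a ℤ.- b)
  neg-difference : ∀ a b → ℤ.- (a ℤ.- b) ≡ b ℤ.- a
  neg-difference a b = GroupProperties.⁻¹-anti-homo-// (CommutativeRing.+-group ℤₚ.+-*-commutativeRing) a b

-- The index k of both products over the positive integers stands for m = 1 + k.

∏ℤ/ : RawTopologicalGroup
∏ℤ/ = ∏ ℕ λ k → ℤ/ suc k

Ẑ : RawTopologicalGroup
Ẑ = subgroup ∏ℤ/ λ a → ∀ k l → suc k ℕ∣.∣ suc l →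
      RawTopologicalGroup._≈_ (ℤ/ suc k) (a l) (a k)

ℝ/ℤ : RawTopologicalGroup
ℝ/ℤ = record
  { setoid = record
    { Carrier = ℝ
    ; _≈_ = _≡₁_
    ; isEquivalence = record
      { refl  = λ {x} → ℤ.0ℤ , R.-‿inverseʳ x
      ; sym   = λ { {x} {y} (k , p) → ℤ.- k , R.trans (R.sym (P.⁻¹-anti-homo-// x y))
                  (R.trans (R.-‿cong p) (ℝ.pointwise λ _ → ≡.sym (neg-/1 k))) }
      ; trans = λ { {x} {y} {z} (k , p) (l , q) → k ℤ.+ l , R.trans (telescope x y z)
                  (R.trans (R.+-cong p q) (ℝ.pointwise λ _ → ≡.sym (+-/1 k l))) } } }
  ; _∙_↦_ = λ x y z → (x ℝ.+ʳ y) ≡₁ z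
  ; Nbhd = λ _ → Radius
  ; _∋_ = λ { {x} (ε , _) y → ∃[ k ] ℝ.∥ (y ℝ.+ʳ ℝ.-ʳ x) ℝ.+ʳ ℝ.-ʳ fromℚ (k / 1) ∥< ε } }
  where
  _≡₁_ : ℝ → ℝ → Set
  x ≡₁ y = ∃[ k ] (x ℝ.+ʳ ℝ.-ʳ y) ℝ.≈ fromℚ (k / 1)
  module R = CommutativeRing ℝ.completionRing
  module P = GroupProperties R.+-group
  telescope : ∀ x y z → x R.- z R.≈ (x R.- y) R.+ (y R.- z)
  telescope x y z = R.sym (R.trans (R.+-assoc x (R.- y) (y R.- z))
    (R.+-congˡ (P.\\-leftDividesʳ y (R.- z))))

𝓔 : ℕ → RawTopologicalGroup
𝓔 n = (∏ (Fin n) λ _ → ℝ/ℤ) ⊗ (∏ (Fin n) λ _ → Ẑ) ⊗ ∏ℤ/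

-- The Weierstrass equation y² = x³ + a₂ x² + a₄ x + a₆.
record Weierstrass (A : Set) : Set where
  constructor weierstrass
  field
    a₂ a₄ a₆ : A

map : ∀ {A B : Set} → (A → B) → Weierstrass A → Weierstrass B
map f (weierstrass a₂ a₄ a₆) = weierstrass (f a₂) (f a₄) (f a₆)

module _ (R : CommutativeRing 0ℓ 0ℓ) where
  open CommutativeRing R
    using (_≈_; 0#; setoid) renaming (Carrier to F; _+_ to _⊕_; _*_ to _⊛_; -_ to ⊖_; _-_ to _⊝_)
  private module R = CommutativeRing R

  module _ (W : Weierstrass F) where
    open Weierstrass W

    data Point : Set where
      𝒪      : Point
      affine : (x y : F) →
               y ⊛ y ≈ ((x ⊛ x ⊛ x ⊕ a₂ ⊛ (x ⊛ x)) ⊕ a₄ ⊛ x) ⊕ a₆ → Point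

    _≈ₚ_ : Point → Point → Set
    𝒪            ≈ₚ 𝒪               = ⊤
    affine x y _ ≈ₚ affine x′ y′ _  = x ≈ x′ × y ≈ y′
    _            ≈ₚ _               = ⊥

    points : Setoid 0ℓ 0ℓ
    points = record
      { Carrier = Point
      ; _≈_ = _≈ₚ_
      ; isEquivalence = record
        { refl  = λ {P} → reflexive P
        ; sym   = λ {P} {Q} → symmetric P Q
        ; trans = λ {P} {Q} {S} → transitive P Q S } }
      where
      reflexive : ∀ P → P ≈ₚ P
      reflexive 𝒪              = tt
      reflexive (affine _ _ _) = R.refl , R.refl
      symmetric : ∀ P Q → P ≈ₚ Q → Q ≈ₚ P
      symmetric 𝒪 𝒪 _ = tt
      symmetric (affine _ _ _) (affine _ _ _) (p , q) = R.sym p , R.sym q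
      transitive : ∀ P Q S → P ≈ₚ Q → Q ≈ₚ S → P ≈ₚ S
      transitive 𝒪 𝒪 𝒪 _ _ = tt
      transitive (affine _ _ _) (affine _ _ _) (affine _ _ _) (p , q) (p′ , q′) =
        R.trans p p′ , R.trans q q′

    -- s is the slope of the chord through two points with distinct
    -- x-coordinates, or of the tangent at a point that is not 2-torsion.
    Slope : (x₁ y₁ x₂ y₂ s : F) → Set
    Slope x₁ y₁ x₂ y₂ s =
        (¬ x₁ ≈ x₂ × s ⊛ (x₂ ⊝ x₁) ≈ y₂ ⊝ y₁)
      ⊎ (x₁ ≈ x₂ × y₁ ≈ y₂ × ¬ y₁ ≈ 0# ×
         s ⊛ (y₁ ⊕ y₁) ≈ ((x₁ ⊛ x₁ ⊕ x₁ ⊛ x₁ ⊕ x₁ ⊛ x₁) ⊕ (a₂ ⊛ x₁ ⊕ a₂ ⊛ x₁)) ⊕ a₄)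

    -- The graph of the chord and tangent addition.
    _+ₚ_↦_ : Point → Point → Point → Set
    𝒪 +ₚ Q ↦ S = Q ≈ₚ S
    P@(affine _ _ _) +ₚ 𝒪 ↦ S = P ≈ₚ S
    affine x₁ y₁ _ +ₚ affine x₂ y₂ _ ↦ 𝒪 = x₁ ≈ x₂ × y₂ ≈ ⊖ y₁
    affine x₁ y₁ _ +ₚ affine x₂ y₂ _ ↦ affine x₃ y₃ _ =
      ∃[ s ] (Slope x₁ y₁ x₂ y₂ s
            × x₃ ≈ (((s ⊛ s) ⊝ a₂) ⊝ x₁) ⊝ x₂
            × y₃ ≈ (s ⊛ (x₁ ⊝ x₃)) ⊝ y₁)

-- The topology on points is that of the projective plane: (x , y) are coordinates
-- at affine points, and (x / y , 1 / y) are coordinates at 𝒪 = (0 : 1 : 0).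
pointGroup : (R : SeminormedRing) → Weierstrass (SeminormedRing.Carrier R) → RawTopologicalGroup
pointGroup R W = record
  { setoid = points R.commutativeRing W
  ; _∙_↦_ = _+ₚ_↦_ R.commutativeRing W
  ; Nbhd = λ _ → Radius
  ; _∋_ = λ { {P} (ε , _) Q → Near P ε Q } }
  where
  module R = SeminormedRing R
  Near : Point R.commutativeRing W → ℚ → Point R.commutativeRing W → Set
  Near 𝒪              ε 𝒪                = ⊤
  Near 𝒪              ε (affine x y _)   =
    ∃[ w ] (y R.⊛ w R.≈ R.1# × R.∣ x R.⊛ w ∣< ε × R.∣ w ∣< ε)
  Near (affine _ _ _) ε 𝒪                = ⊥
  Near (affine x y _) ε (affine x′ y′ _) = R.∣ x′ R.- x ∣< ε × R.∣ y′ R.- y ∣< ε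

module _ {d} (K : NumberField d) (W : Weierstrass (NumberField.Carrier K)) where

  private
    PointAt : AbsoluteValue K → Set
    PointAt v = Carrier (pointGroup (completionAt v) (map (fromBase v) W))

  Corresponding : (v w : AbsoluteValue K) → v ∼ w → PointAt v → PointAt w → Set
  Corresponding v w e 𝒪              𝒪                = ⊤
  Corresponding v w e (affine x y _) (affine x′ y′ _) =
      SeminormedRing._≈_ (completionAt w) (transfer v w e x) x′
    × SeminormedRing._≈_ (completionAt w) (transfer v w e y) y′
  Corresponding v w e _              _                = ⊥

  -- An element of the product over all primes is a family indexed by all
  -- absolute values that agrees on equivalent ones.
  adelicPointGroup : RawTopologicalGroup
  adelicPointGroup = subgroup
    (∏ (AbsoluteValue K) λ v → pointGroup (completionAt v) (map (fromBase v) W))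
    (λ P → ∀ v w (e : v ∼ w) → Corresponding v w e (P v) (P w))

private
  two four : ℚ
  two  = ℤ.+ 2 / 1
  four = ℤ.+ 4 / 1

-- x (x² - 2 (1 - 4 r⁴) x + (1 + 4 r⁴)²), expanded.
E : ℚ → Weierstrass ℚ
E r = weierstrass (- (two * (1ℚ - four * r⁴))) ((1ℚ + four * r⁴) * (1ℚ + four * r⁴)) 0ℚ
  where
  r⁴ : ℚ
  r⁴ = r * r * r * r

E_over_ : ∀ {d} → ℚ → (K : NumberField d) → Weierstrass (NumberField.Carrier K)
E r over K = map (NumberField.ι K) (E r)

-- For r ≢ 0 the cubic has no multiple root, so E r is an elliptic curve and the
-- graph above is that of a group law. The discriminant of x³ + a x² + b x is
-- b² (a² - 4 b).
E-nonsingular : ∀ r → r ≢ 0ℚ → let open Weierstrass (E r) in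
                a₄ * a₄ * (a₂ * a₂ - four * a₄) ≢ 0ℚ
E-nonsingular r r≢0 = ≡.subst (_≢ 0ℚ) (≡.sym factorisation)
  (product≢0 (product≢0 (product≢0 u≢0 u≢0) (product≢0 u≢0 u≢0)) (product≢0 {ℤ.-[1+ 63 ] / 1} (λ ()) t≢0))
  where
  t u : ℚ
  t = r * r * r * r
  u = 1ℚ + four * t

  product≢0 : ∀ {p q} → p ≢ 0ℚ → q ≢ 0ℚ → p * q ≢ 0ℚ
  product≢0 {p} {q} p≢0 q≢0 pq≡0 = q≢0 (begin
    q                 ≡⟨ *-identityˡ q ⟨
    1ℚ * q            ≡⟨ ≡.cong (_* q) (*-inverseˡ p) ⟨
    (1/ p) * p * q    ≡⟨ *-assoc (1/ p) p q ⟩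
    (1/ p) * (p * q)  ≡⟨ ≡.cong ((1/ p) *_) pq≡0 ⟩
    (1/ p) * 0ℚ       ≡⟨ *-zeroʳ (1/ p) ⟩
    0ℚ                ∎)
    where
    open ≡.≡-Reasoning
    instance p-nonZero = ≢-nonZero p≢0

  t≢0 : t ≢ 0ℚ
  t≢0 = product≢0 (product≢0 (product≢0 r≢0 r≢0) r≢0) r≢0

  0≤square : ∀ q → 0ℚ ≤ q * q
  0≤square q = ≡.subst (0ℚ ≤_) (absorb (∣p∣≡p∨∣p∣≡-p q)) (0≤∣p∣ (q * q))
    where
    absorb : ∣ q ∣ ≡ q ⊎ ∣ q ∣ ≡ - q → ∣ q * q ∣ ≡ q * q
    absorb (inj₁ eq) = ≡.trans (∣p*q∣≡∣p∣*∣q∣ q q) (≡.cong₂ _*_ eq eq)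
    absorb (inj₂ eq) = ≡.trans (∣p*q∣≡∣p∣*∣q∣ q q) (≡.trans (≡.cong₂ _*_ eq eq)
      (solve 1 (λ q → (:- q) :* (:- q) := q :* q) ≡.refl q))
      where open +-*-Solver

  u≢0 : u ≢ 0ℚ
  u≢0 u≡0 = <⇒≢ (<-≤-trans (positive⁻¹ 1ℚ) 1≤u) (≡.sym u≡0)
    where
    open ≤-Reasoning
    open +-*-Solver
    1≤u : 1ℚ ≤ u
    1≤u = begin
      1ℚ                                     ≡⟨ +-identityʳ 1ℚ ⟨
      1ℚ + 0ℚ                                ≤⟨ +-monoʳ-≤ 1ℚ (0≤square (two * (r * r))) ⟩
      1ℚ + (two * (r * r)) * (two * (r * r)) ≡⟨ solve 1 (λ r → con 1ℚ :+ (con two :* (r :* r)) :* (con two :* (r :* r))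
                                                  := con 1ℚ :+ con four :* (r :* r :* r :* r)) ≡.refl r ⟩
      u                                      ∎

  factorisation : let open Weierstrass (E r) in
    a₄ * a₄ * (a₂ * a₂ - four * a₄) ≡ (u * u) * (u * u) * ((ℤ.-[1+ 63 ] / 1) * t)
  factorisation = ≡.cong ((u * u) * (u * u) *_)
    (solve 1 (λ t →
      (:- (con two :* (con 1ℚ :- con four :* t))) :* (:- (con two :* (con 1ℚ :- con four :* t)))
        :- con four :* ((con 1ℚ :+ con four :* t) :* (con 1ℚ :+ con four :* t))
      := con (ℤ.-[1+ 63 ] / 1) :* t) ≡.refl t)
    where open +-*-Solver

module Submission where

-- Already the abstract groups differ: in E_r(A_K) every point T with 2 T = O is of the form
-- 2 S, whereas the generator of the factor ℤ/2ℤ of 𝓔 n is killed by 2 and is not a double.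
--
-- Let A = 1 - 4 r⁴ and B = 1 + 4 r⁴, so that the cubic is t q(t) with q(t) = t² - 2 A t + B²,
-- and let (t , 0) be a point over a completion. If t = 0, the rational point (B , 4 r² B)
-- has double (t , 0). If q(t) = 0, then t = (1 + 2 i r²)² for a square root i of -1 in
-- the completion, and t minus the other root of q is 8 i r² = (2 (1 + i) r)²; as both
-- differences of t with the other 2-torsion abscissas are squares, (t , 0) is a double.
-- Here i is a polynomial in t over ℚ, and e = q(t) / B² is an idempotent that is 1 in
-- the first case and 0 in the second, so S is given by polynomials in t for which the
-- cases need not be distinguished. In particular S is compatible with the isomorphisms
-- between completions at equivalent absolute values.

open import Defs
open ℝ using (fromℚ)
open import Level using (0ℓ)
open import Data.Nat.Base as ℕ using (ℕ; suc)
import Data.Nat.Properties as ℕₚ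
open import Data.Nat.Divisibility using (∣1⇒≡1)
open import Data.Integer.Base as ℤ using (+_)
import Data.Integer.Solver as ℤ-Solver
open import Data.Fin.Base using (Fin)
open import Algebra.Apartness.Bundles using (HeytingField)
import Data.Integer.Divisibility.Signed as ℤ∣
open import Data.Rational.Base as ℚ using (ℚ; 0ℚ; ½) renaming (_/_ to _÷_)
import Data.Rational.Properties as ℚₚ
import Data.Rational.Solver as ℚ-Solver
import Data.Maybe.Base as Maybe
open import Data.Product.Base using (∃-syntax; _×_; _,_; proj₁; proj₂)
open import Data.Sum.Base using (inj₁; inj₂)
open import Data.Unit.Base using (⊤; tt)
open import Data.Empty using (⊥-elim)
open import Function.Base using (_∘_)
open import Function.Bundles using (Equivalence; Inverse)
open import Relation.Nullary.Negation using (¬_; contradiction)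
open import Relation.Nullary.Decidable using (dec⇒maybe)
open import Relation.Binary.Bundles using (Setoid)
open import Relation.Binary.PropositionalEquality as ≡ using (_≡_; _≢_)
open import Algebra.Bundles using (CommutativeRing)
open import Algebra.Morphism.Structures using (module RingMorphisms)
import Algebra.Morphism.Construct.Composition as Composition
open import Algebra.Solver.Ring.AlmostCommutativeRing using (fromCommutativeRing; _-Raw-AlmostCommutative⟶_)
import Algebra.Solver.Ring
import Algebra.Properties.Group as GroupProperties

-- Halving 2-torsion points over a ℚ-algebra.

IsℚAlgebra : (R : CommutativeRing 0ℓ 0ℓ) → (ℚ → CommutativeRing.Carrier R) → Set
IsℚAlgebra R = RingMorphisms.IsRingHomomorphism ℚ.+-*-rawRing (CommutativeRing.rawRing R)

Nontrivial : CommutativeRing 0ℓ 0ℓ → Set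
Nontrivial R = ¬ 1# ≈ 0#
  where open CommutativeRing R

-- The ring solver runs with rational coefficients interpreted through `φ`. This is why constants
-- below appear as `φ q`, and zero and one often as `φ (+ 0 ÷ 1)` and `φ ℚ.1ℚ` instead of `0#` and
-- `1#`.
module ℚ-Algebra
  (R : CommutativeRing 0ℓ 0ℓ) {φ : ℚ → CommutativeRing.Carrier R} (φ-homo : IsℚAlgebra R φ) where

  open CommutativeRing R hiding (zero)
  open RingMorphisms.IsRingHomomorphism φ-homo

  private
    ℚ⟶R : ℚ.+-*-rawRing -Raw-AlmostCommutative⟶ fromCommutativeRing R
    ℚ⟶R = record { ⟦_⟧ = φ ; +-homo = +-homo ; *-homo = *-homo ; -‿homo = -‿homo
                 ; 0-homo = 0#-homo ; 1-homo = 1#-homo }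

  open Algebra.Solver.Ring ℚ.+-*-rawRing (fromCommutativeRing R) ℚ⟶R
    (λ p q → Maybe.map ⟦⟧-cong (dec⇒maybe (p ℚₚ.≟ q)))

  zero one two four : ∀ {n} → Polynomial n
  zero = con ℚ.0ℚ
  one  = con ℚ.1ℚ
  two  = con (+ 2 ÷ 1)
  four = con (+ 4 ÷ 1)

  -- An identity that holds modulo hypotheses lᵢ ≈ rᵢ is proved by the solver in
  -- the form x ≈ y + Σ cᵢ (lᵢ - rᵢ).
  modulo : ∀ {x y z} → x ≈ y + z → z ≈ 0# → x ≈ y
  modulo {y = y} p z≈0 = trans p (trans (+-congˡ z≈0) (+-identityʳ y))

  infixl 6 _⟨+⟩_
  infixl 7 _·_

  _⟨+⟩_ : ∀ {x y} → x ≈ 0# → y ≈ 0# → x + y ≈ 0#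
  p ⟨+⟩ q = trans (+-cong p q) (+-identityʳ 0#)

  _·_ : ∀ c {l r} → l ≈ r → c * (l - r) ≈ 0#
  c · p = trans (*-congˡ (trans (+-congʳ p) (-‿inverseʳ _))) (zeroʳ c)

  y≈-y⇒y≈0 : ∀ {y} → y ≈ - y → y ≈ 0#
  y≈-y⇒y≈0 {y} p = trans (modulo (solve 1 (λ y → y := zero :+ con ½ :* (y :- :- y)) refl y)
                            (φ ½ · p)) 0#-homo

  cubic : (a b c x : Carrier) → Carrier
  cubic a b c x = ((x * x * x + a * (x * x)) + b * x) + c

  derivative : (a b x : Carrier) → Carrier
  derivative a b x = ((x * x + x * x + x * x) + (a * x + a * x)) + b

  -- If (t , 0) is on y² = f(x), then y² = z³ + ½ f″(t) z² + f′(t) z for z = x - t, and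
  -- (X , s X) is a point with tangent y = s z as soon as X² = f′(t) and s² = ½ f″(t) + 2 X.
  module _ {a b c t X s : Carrier} (root : cubic a b c t ≈ 0#)
           (X² : X * X ≈ derivative a b t) (s² : s * s ≈ (a + (t + t + t)) + (X + X)) where

    half-on-curve : (s * X) * (s * X) ≈ cubic a b c (t + X)
    half-on-curve = modulo (solve 6 (λ a b c t X s →
        (s :* X) :* (s :* X) :=
          ((((t :+ X) :* (t :+ X) :* (t :+ X)) :+ a :* ((t :+ X) :* (t :+ X))) :+ b :* (t :+ X)) :+ c
          :+ (X :* X :* (s :* s :- ((a :+ (t :+ t :+ t)) :+ (X :+ X)))
          :+ X :* (X :* X :- (((t :* t :+ t :* t :+ t :* t) :+ (a :* t :+ a :* t)) :+ b))
          :+ (:- one) :* ((((t :* t :* t) :+ a :* (t :* t)) :+ b :* t :+ c) :- zero)))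
        refl a b c t X s)
      (X * X · s² ⟨+⟩ X · X² ⟨+⟩ _ · trans root (sym 0#-homo))

    half-tangent : s * (s * X + s * X) ≈ derivative a b (t + X)
    half-tangent = modulo (solve 5 (λ a b t X s →
        s :* (s :* X :+ s :* X) :=
          ((((t :+ X) :* (t :+ X) :+ (t :+ X) :* (t :+ X) :+ (t :+ X) :* (t :+ X)))
            :+ (a :* (t :+ X) :+ a :* (t :+ X))) :+ b
          :+ ((X :+ X) :* (s :* s :- ((a :+ (t :+ t :+ t)) :+ (X :+ X)))
          :+ one :* (X :* X :- (((t :* t :+ t :* t :+ t :* t) :+ (a :* t :+ a :* t)) :+ b))))
        refl a b t X s)
      ((X + X) · s² ⟨+⟩ _ · X²)

    half-doubles-x : t ≈ ((s * s - a) - (t + X)) - (t + X)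
    half-doubles-x = modulo (solve 4 (λ a t X s →
        t := (((s :* s :- a) :- (t :+ X)) :- (t :+ X))
          :+ (:- one) :* (s :* s :- ((a :+ (t :+ t :+ t)) :+ (X :+ X))))
        refl a t X s)
      (_ · s²)

  half-doubles-y : ∀ t X s → 0# ≈ s * ((t + X) - t) - s * X
  half-doubles-y t X s = trans (sym 0#-homo)
    (solve 3 (λ t X s → zero := s :* ((t :+ X) :- t) :- s :* X) refl t X s)

  -- The discriminant lies in the ideal generated by the cubic and its derivative; the two long
  -- factors are Bézout cofactors, of degrees 1 and 2 in `x`.
  discriminant-vanishes : ∀ {a b x} → cubic a b 0# x ≈ 0# → derivative a b x ≈ 0# →
                          b * b * (a * a - φ (+ 4 ÷ 1) * b) ≈ 0#
  discriminant-vanishes {a} {b} {x} f f′ = trans (modulo (solve 3 (λ a b x →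
        b :* b :* (a :* a :- four :* b) :=
          zero
          :+ ((((:- con (+ 6 ÷ 1)) :* (a :* a :- con (+ 3 ÷ 1) :* b)) :* x
               :+ (con (+ 15 ÷ 1) :* a :* b :- four :* a :* a :* a))
                :* ((((x :* x :* x) :+ a :* (x :* x)) :+ b :* x :+ zero) :- zero)
          :+ ((two :* (a :* a :- con (+ 3 ÷ 1) :* b)) :* x :* x
               :+ (two :* a :* a :* a :- con (+ 7 ÷ 1) :* a :* b) :* x
               :+ b :* (a :* a :- four :* b))
                :* ((((x :* x :+ x :* x :+ x :* x) :+ (a :* x :+ a :* x)) :+ b) :- zero)))
        refl a b x)
      (_ · trans (trans (+-congˡ 0#-homo) f) (sym 0#-homo) ⟨+⟩ _ · trans f′ (sym 0#-homo))) 0#-homo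

  -- The explicit half, glued from two cases by an idempotent.

  module Halving {A B a b r ρ β : Carrier}
    (A+B : A + B ≈ φ (+ 2 ÷ 1)) (B-A : B - A ≈ φ (+ 8 ÷ 1) * ((r * r) * (r * r)))
    (a≈ : a ≈ - (φ (+ 2 ÷ 1) * A)) (b≈ : b ≈ B * B) (ρr : ρ * r ≈ φ ℚ.1ℚ) (βB : β * B ≈ φ ℚ.1ℚ) where

    -- √t and d are 1 + 2 i r² and 2 (1 + i) r, expressed by t = A + 4 i r².
    quadratic idempotent complement √t d : Carrier → Carrier
    quadratic  t = (t * t + a * t) + b
    idempotent t = (β * β) * quadratic t
    complement t = φ ℚ.1ℚ - idempotent t
    √t         t = φ ½ * (t + B)
    d          t = φ (+ 2 ÷ 1) * r + (φ ½ * ρ) * (t - A)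

    -- Where t = 0, the conditions are `X`² = b = B² and `slope`² = a + 2 B = 2 (B - A) = 16 r⁴.
    -- Where the quadratic factor vanishes, `√t`² = t and `d`² is t minus the other root, so `X` =
    -- `√t` `d` and `slope` = `√t` + `d`.
    X slope : Carrier → Carrier
    X     t = idempotent t * B + complement t * (√t t * d t)
    slope t = idempotent t * (φ (+ 4 ÷ 1) * (r * r)) + complement t * (√t t + d t)

    private
      quadratic-cong : ∀ {t t′} → t ≈ t′ → quadratic t ≈ quadratic t′
      quadratic-cong p = +-congʳ (+-cong (*-cong p p) (*-congˡ p))

      complement-cong : ∀ {t t′} → t ≈ t′ → complement t ≈ complement t′
      complement-cong p = +-congˡ (-‿cong (*-congˡ (quadratic-cong p)))

      √t-cong : ∀ {t t′} → t ≈ t′ → √t t ≈ √t t′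
      √t-cong p = *-congˡ (+-congʳ p)

      d-cong : ∀ {t t′} → t ≈ t′ → d t ≈ d t′
      d-cong p = +-congˡ (*-congˡ (+-congʳ p))

    X-cong : ∀ {t t′} → t ≈ t′ → X t ≈ X t′
    X-cong p = +-cong (*-congʳ (*-congˡ (quadratic-cong p)))
                      (*-cong (complement-cong p) (*-cong (√t-cong p) (d-cong p)))

    slope-cong : ∀ {t t′} → t ≈ t′ → slope t ≈ slope t′
    slope-cong p = +-cong (*-congʳ (*-congˡ (quadratic-cong p)))
                          (*-cong (complement-cong p) (+-cong (√t-cong p) (d-cong p)))

    module _ {t : Carrier} (root : cubic a b 0# t ≈ 0#) where

      private
        q e f w D : Carrier
        q = quadratic t
        e = idempotent t
        f = complement t
        w = √t t
        D = d t

        tq : t * q ≈ φ (+ 0 ÷ 1)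
        tq = modulo (solve 3 (λ a b t →
            t :* ((t :* t :+ a :* t) :+ b) := zero
            :+ one :* ((((t :* t :* t) :+ a :* (t :* t)) :+ b :* t :+ zero) :- zero))
            refl a b t)
          (_ · trans (trans (+-congˡ 0#-homo) root) (sym 0#-homo))

        et : e * t ≈ φ (+ 0 ÷ 1)
        et = modulo (solve 3 (λ β q t → (β :* β) :* q :* t := zero
               :+ (β :* β) :* (t :* q :- zero)) refl β q t) (_ · tq)

        -- q² = t q (t + a) + b q
        q² : q * q ≈ q * (B * B)
        q² = modulo (solve 4 (λ a b B t → let q = (t :* t :+ a :* t) :+ b in
               q :* q := q :* (B :* B) :+ ((t :+ a) :* (t :* q :- zero) :+ q :* (b :- B :* B)))
               refl a b B t) (_ · tq ⟨+⟩ _ · b≈)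

        -- Since β² q² = q, the factor `f` = 1 - β² q annihilates q and hence `e`. The ring thus
        -- splits into a part where t vanishes (`et`) and a part where q vanishes.
        fq : f * q ≈ φ (+ 0 ÷ 1)
        fq = modulo (solve 3 (λ β q B →
               (one :- (β :* β) :* q) :* q := zero
               :+ ((:- (β :* β)) :* (q :* q :- q :* (B :* B))
               :+ (:- (q :* (β :* B :+ one))) :* (β :* B :- one)))
               refl β q B) (_ · q² ⟨+⟩ _ · βB)

        fe : f * e ≈ φ (+ 0 ÷ 1)
        fe = modulo (solve 3 (λ f q β → f :* ((β :* β) :* q) := zero
               :+ (β :* β) :* (f :* q :- zero)) refl f q β) (_ · fq)

        f+e : f + e ≈ φ (+ 1 ÷ 1)
        f+e = solve 1 (λ e → (one :- e) :+ e := one) refl e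

        -- 4 (w² - t) = (t + B)² - 4 t, which equals q because A + B = 2.
        fw² : f * (w * w) ≈ f * t
        fw² = modulo (solve 6 (λ A B a b t f →
                let w = con ½ :* (t :+ B) ; q = (t :* t :+ a :* t) :+ b in
                f :* (w :* w) := f :* t
                :+ (con (+ 1 ÷ 4) :* (f :* q :- zero)
                :+ (con ½ :* f :* t) :* (A :+ B :- two)
                :+ (:- (con (+ 1 ÷ 4) :* f :* t)) :* (a :- (:- (two :* A)))
                :+ (:- (con (+ 1 ÷ 4) :* f)) :* (b :- B :* B)))
                refl A B a b t f)
              (_ · fq ⟨+⟩ _ · A+B ⟨+⟩ _ · a≈ ⟨+⟩ _ · b≈)

        16r⁴ : φ (+ 16 ÷ 1) * ((r * r) * (r * r)) ≈ B * B - A * A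
        16r⁴ = modulo (solve 3 (λ A B r →
                 con (+ 16 ÷ 1) :* ((r :* r) :* (r :* r)) := (B :* B :- A :* A)
                 :+ ((:- two) :* ((B :- A) :- con (+ 8 ÷ 1) :* ((r :* r) :* (r :* r)))
                 :+ (:- (B :- A)) :* (A :+ B :- two)))
                 refl A B r) (_ · B-A ⟨+⟩ _ · A+B)

        -- 4 (d² - 2 (t - A)) = 16 r² + ρ² (t - A)² = ρ² (16 r⁴ + (t - A)²) = ρ² q
        fd² : f * (D * D) ≈ f * (φ (+ 2 ÷ 1) * (t - A))
        fd² = modulo (solve 8 (λ A B a b t f r ρ →
                let d = two :* r :+ (con ½ :* ρ) :* (t :- A) ; q = (t :* t :+ a :* t) :+ b in
                f :* (d :* d) := f :* (two :* (t :- A))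
                :+ (con (+ 1 ÷ 4) :* ρ :* ρ :* (f :* q :- zero)
                :+ (f :* (two :* (t :- A)) :- four :* f :* r :* r :* (ρ :* r :+ one))
                     :* (ρ :* r :- one)
                :+ (con (+ 1 ÷ 4) :* ρ :* ρ :* f)
                     :* (con (+ 16 ÷ 1) :* ((r :* r) :* (r :* r)) :- (B :* B :- A :* A))
                :+ (:- (con (+ 1 ÷ 4) :* ρ :* ρ :* f :* t)) :* (a :- (:- (two :* A)))
                :+ (:- (con (+ 1 ÷ 4) :* ρ :* ρ :* f)) :* (b :- B :* B)))
                refl A B a b t f r ρ)
              (_ · fq ⟨+⟩ _ · ρr ⟨+⟩ _ · 16r⁴ ⟨+⟩ _ · a≈ ⟨+⟩ _ · b≈)

      -- Multiplication by `e` kills t and leaves b = B² of the derivative. The derivative is also q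
      -- + t (2 t + a), so multiplication by `f` leaves t times 2 (t - A), which is w² d² by `fw²`
      -- and `fd²`.
      X² : X t * X t ≈ derivative a b t
      X² = modulo (solve 9 (λ A B a b t e f w d →
             let X = e :* B :+ f :* (w :* d)
                 f′ = ((t :* t :+ t :* t :+ t :* t) :+ (a :* t :+ a :* t)) :+ b in
             X :* X := f′
             :+ ((two :* B :* w :* d :- B :* B :- w :* w :* d :* d) :* (f :* e :- zero)
             :+ (e :* B :* B :+ f :* w :* w :* d :* d :+ f′) :* (f :+ e :- one)
             :+ (:- e) :* (b :- B :* B)
             :+ (:- (con (+ 3 ÷ 1) :* t :+ two :* a)) :* (e :* t :- zero)
             :+ (d :* d) :* (f :* (w :* w) :- f :* t)
             :+ t :* (f :* (d :* d) :- f :* (two :* (t :- A)))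
             :+ (:- one) :* (f :* ((t :* t :+ a :* t) :+ b) :- zero)
             :+ (:- (f :* t)) :* (a :- (:- (two :* A)))))
             refl A B a b t e f w D)
           (_ · fe ⟨+⟩ _ · f+e ⟨+⟩ _ · b≈ ⟨+⟩ _ · et ⟨+⟩ _ · fw² ⟨+⟩ _ · fd² ⟨+⟩ _ · fq ⟨+⟩ _ · a≈)

      -- On the `e` part both sides are 16 r⁴. On the `f` part w² + d² = t + 2 (t - A) = a + 3 t,
      -- and the cross term 2 w d is 2 `X`.
      slope² : slope t * slope t ≈ (a + (t + t + t)) + (X t + X t)
      slope² = modulo (solve 9 (λ A B a t e f w d r →
             let X = e :* B :+ f :* (w :* d) ; s = e :* (four :* (r :* r)) :+ f :* (w :+ d)
                 r⁴ = (r :* r) :* (r :* r) in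
             s :* s := (a :+ (t :+ t :+ t)) :+ (X :+ X)
             :+ ((con (+ 8 ÷ 1) :* r :* r :* (w :+ d) :- con (+ 16 ÷ 1) :* r⁴ :- (w :+ d) :* (w :+ d)) :* (f :* e :- zero)
             :+ (e :* con (+ 16 ÷ 1) :* r⁴ :+ f :* (w :+ d) :* (w :+ d) :+ a :+ con (+ 3 ÷ 1) :* t) :* (f :+ e :- one)
             :+ (:- (two :* e)) :* ((B :- A) :- con (+ 8 ÷ 1) :* r⁴)
             :+ (:- (e :+ f)) :* (a :- (:- (two :* A)))
             :+ (:- con (+ 3 ÷ 1)) :* (e :* t :- zero)
             :+ one :* (f :* (w :* w) :- f :* t)
             :+ one :* (f :* (d :* d) :- f :* (two :* (t :- A)))))
             refl A B a t e f w D r)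
           (_ · fe ⟨+⟩ _ · f+e ⟨+⟩ _ · B-A ⟨+⟩ _ · a≈ ⟨+⟩ _ · et ⟨+⟩ _ · fw² ⟨+⟩ _ · fd²)

-- Halving on `E r` over a nontrivial ℚ-algebra.

module _ (r : ℚ) (r≢0 : r ≢ 0ℚ) where

  private
    r⁴ A B : ℚ
    r⁴ = r ℚ.* r ℚ.* r ℚ.* r
    A  = ℚ.1ℚ ℚ.- (+ 4 ÷ 1) ℚ.* r⁴
    B  = ℚ.1ℚ ℚ.+ (+ 4 ÷ 1) ℚ.* r⁴

    A+B≡2 : A ℚ.+ B ≡ + 2 ÷ 1
    A+B≡2 = solve 1 (λ u → (con ℚ.1ℚ :- con (+ 4 ÷ 1) :* u) :+ (con ℚ.1ℚ :+ con (+ 4 ÷ 1) :* u)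
                        := con (+ 2 ÷ 1)) ≡.refl r⁴
      where open ℚ-Solver.+-*-Solver

    B-A≡8r⁴ : B ℚ.- A ≡ (+ 8 ÷ 1) ℚ.* ((r ℚ.* r) ℚ.* (r ℚ.* r))
    B-A≡8r⁴ = solve 1 (λ r → (con ℚ.1ℚ :+ con (+ 4 ÷ 1) :* (r :* r :* r :* r))
                               :- (con ℚ.1ℚ :- con (+ 4 ÷ 1) :* (r :* r :* r :* r))
                          := con (+ 8 ÷ 1) :* ((r :* r) :* (r :* r))) ≡.refl r
      where open ℚ-Solver.+-*-Solver

    -- B² is the coefficient `a₄`, whose square divides the discriminant.
    B≢0 : B ≢ 0ℚ
    B≢0 B≡0 = E-nonsingular r r≢0 (≡.trans
      (≡.cong (λ u → u ℚ.* u ℚ.* (u ℚ.* u) ℚ.* (a₂ ℚ.* a₂ ℚ.- (+ 4 ÷ 1) ℚ.* (B ℚ.* B))) B≡0)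
      (ℚₚ.*-zeroˡ (a₂ ℚ.* a₂ ℚ.- (+ 4 ÷ 1) ℚ.* (B ℚ.* B))))
      where open Weierstrass (E r)

    inverse : ∀ p → p ≢ 0ℚ → ∃[ q ] q ℚ.* p ≡ ℚ.1ℚ
    inverse p p≢0 = (ℚ.1/ p) , ℚₚ.*-inverseˡ p
      where instance _ = ℚ.≢-nonZero p≢0

  module HalfPoint
    (R : CommutativeRing 0ℓ 0ℓ) {φ : ℚ → CommutativeRing.Carrier R}
    (φ-homo : IsℚAlgebra R φ) (1≉0 : Nontrivial R) where

    open CommutativeRing R
    open RingMorphisms.IsRingHomomorphism φ-homo
    open ℚ-Algebra R φ-homo

    private
      W : Weierstrass Carrier
      W = map φ (E r)

      module W = Weierstrass W

      r⁻¹ B⁻¹ : ℚ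
      r⁻¹ = proj₁ (inverse r r≢0)
      B⁻¹ = proj₁ (inverse B B≢0)

      module H = Halving {φ A} {φ B} {W.a₂} {W.a₄} {φ r} {φ r⁻¹} {φ B⁻¹}
        (trans (sym (+-homo A B)) (⟦⟧-cong A+B≡2))
        (trans (trans (+-congˡ (sym (-‿homo A))) (sym (+-homo B (ℚ.- A)))) (trans (⟦⟧-cong B-A≡8r⁴)
          (trans (*-homo (+ 8 ÷ 1) _) (*-congˡ (trans (*-homo _ _) (*-cong (*-homo r r) (*-homo r r)))))))
        (trans (-‿homo _) (-‿cong (*-homo (+ 2 ÷ 1) A)))
        (*-homo B B)
        (trans (sym (*-homo r⁻¹ r)) (⟦⟧-cong (proj₂ (inverse r r≢0))))
        (trans (sym (*-homo B⁻¹ B)) (⟦⟧-cong (proj₂ (inverse B B≢0))))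

    halfX halfY : Carrier → Carrier
    halfX t = t + H.X t
    halfY t = H.slope t * H.X t

    halfX-cong : ∀ {t t′} → t ≈ t′ → halfX t ≈ halfX t′
    halfX-cong p = +-cong p (H.X-cong p)

    halfY-cong : ∀ {t t′} → t ≈ t′ → halfY t ≈ halfY t′
    halfY-cong p = *-cong (H.slope-cong p) (H.X-cong p)

    TwoTorsion : Point R W → Set
    TwoTorsion 𝒪              = ⊤
    TwoTorsion (affine _ y _) = y ≈ 0#

    private abstract
      root : ∀ {x y} → y * y ≈ cubic W.a₂ W.a₄ W.a₆ x → y ≈ 0# → cubic W.a₂ W.a₄ W.a₆ x ≈ 0#
      root eq y≈0 = trans (sym eq) (trans (*-congʳ y≈0) (zeroˡ _))

      root₀ : ∀ {x} → cubic W.a₂ W.a₄ W.a₆ x ≈ 0# → cubic W.a₂ W.a₄ 0# x ≈ 0#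
      root₀ eq = trans (+-congˡ (sym 0#-homo)) eq

      on-curve : ∀ {x} → cubic W.a₂ W.a₄ W.a₆ x ≈ 0# →
                 halfY x * halfY x ≈ cubic W.a₂ W.a₄ W.a₆ (halfX x)
      on-curve {x} p = half-on-curve p (H.X² (root₀ p)) (H.slope² (root₀ p))

      tangent : ∀ {x} → cubic W.a₂ W.a₄ W.a₆ x ≈ 0# →
                H.slope x * (halfY x + halfY x) ≈ derivative W.a₂ W.a₄ (halfX x)
      tangent p = half-tangent p (H.X² (root₀ p)) (H.slope² (root₀ p))

      -- If the ordinate were zero, the curve and tangent equations would make the cubic and its
      -- derivative vanish at `halfX x`, hence also the discriminant. But that is the image of a
      -- nonzero rational, so a unit.
      halfY≉0 : ∀ {x} → cubic W.a₂ W.a₄ W.a₆ x ≈ 0# → ¬ halfY x ≈ 0#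
      halfY≉0 {x} p y≈0 = 1≉0 (begin
        1#             ≈⟨ 1#-homo ⟨
        φ ℚ.1ℚ         ≈⟨ ⟦⟧-cong (proj₂ (inverse Δ (E-nonsingular r r≢0))) ⟨
        φ (Δ⁻¹ ℚ.* Δ)  ≈⟨ *-homo Δ⁻¹ Δ ⟩
        φ Δ⁻¹ * φ Δ    ≈⟨ *-congˡ φΔ≈0 ⟩
        φ Δ⁻¹ * 0#     ≈⟨ zeroʳ _ ⟩
        0#             ∎)
        where
        open import Relation.Binary.Reasoning.Setoid setoid
        open Weierstrass (E r)
        Δ Δ⁻¹ : ℚ
        Δ   = a₄ ℚ.* a₄ ℚ.* (a₂ ℚ.* a₂ ℚ.- (+ 4 ÷ 1) ℚ.* a₄)
        Δ⁻¹ = proj₁ (inverse Δ (E-nonsingular r r≢0))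
        φΔ : ∀ a b → φ (b ℚ.* b ℚ.* (a ℚ.* a ℚ.- (+ 4 ÷ 1) ℚ.* b))
                     ≈ φ b * φ b * (φ a * φ a - φ (+ 4 ÷ 1) * φ b)
        φΔ a b = trans (*-homo _ _) (*-cong (*-homo b b) (trans (+-homo _ _)
          (+-cong (*-homo a a) (trans (-‿homo _) (-‿cong (*-homo _ b))))))
        φΔ≈0 : φ Δ ≈ 0#
        φΔ≈0 = trans (φΔ a₂ a₄) (discriminant-vanishes
          (root₀ (root (on-curve p) y≈0))
          (trans (sym (tangent p)) (trans (*-congˡ (trans (+-cong y≈0 y≈0) (+-identityˡ 0#))) (zeroʳ _))))

      half-doubles : ∀ {x y} (p : cubic W.a₂ W.a₄ W.a₆ x ≈ 0#) → y ≈ 0# → ∃[ s ]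
          (Slope R W (halfX x) (halfY x) (halfX x) (halfY x) s
           × x ≈ ((s * s - W.a₂) - halfX x) - halfX x
           × y ≈ s * (halfX x - x) - halfY x)
      half-doubles {x} p y≈0 = H.slope x ,
        inj₂ (refl , refl , halfY≉0 p , tangent p) ,
        half-doubles-x p (H.X² (root₀ p)) (H.slope² (root₀ p)) ,
        trans y≈0 (half-doubles-y x _ _)

    half : (P : Point R W) → TwoTorsion P → Point R W
    half 𝒪               _   = 𝒪
    half (affine x y eq) y≈0 = affine (halfX x) (halfY x) (on-curve (root eq y≈0))

    half+half : ∀ P (p : TwoTorsion P) → _+ₚ_↦_ R W (half P p) (half P p) P
    half+half 𝒪               _   = tt
    half+half (affine x y eq) y≈0 = half-doubles (root eq y≈0) y≈0

    -- This recognises the neutral element from the graph alone. A chord needs distinct abscissas,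
    -- and a tangent would give y = s (x - x) - y, so y = 0, which `Slope` excludes.
    idempotent⇒𝒪 : ∀ P → _+ₚ_↦_ R W P P P → P ≡ 𝒪
    idempotent⇒𝒪 𝒪 _ = ≡.refl
    idempotent⇒𝒪 (affine x y _) (s , inj₁ (x≉x , _) , _) = ⊥-elim (x≉x refl)
    idempotent⇒𝒪 (affine x y _) (s , inj₂ (_ , _ , y≉0 , _) , _ , y≈) =
      ⊥-elim (y≉0 (y≈-y⇒y≈0 (trans y≈ (trans (+-congʳ
        (trans (*-congˡ (-‿inverseʳ x)) (zeroʳ s))) (+-identityˡ (- y))))))

    twoTorsion : ∀ P {O} → _+ₚ_↦_ R W P P O → _+ₚ_↦_ R W O O O → TwoTorsion P
    twoTorsion 𝒪 _ _ = tt
    twoTorsion (affine x y _) {O} p o with ≡.refl ← idempotent⇒𝒪 O o = y≈-y⇒y≈0 (proj₂ p)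

-- Completions of K as nontrivial ℚ-algebras.

p≤∣p∣ : ∀ p → p ℚ.≤ ℚ.∣ p ∣
p≤∣p∣ p with ℚₚ.≤-total 0ℚ p
... | inj₁ 0≤p = ℚₚ.≤-reflexive (≡.sym (ℚₚ.0≤p⇒∣p∣≡p 0≤p))
... | inj₂ p≤0 = ℚₚ.≤-trans p≤0 (ℚₚ.0≤∣p∣ p)

-- The hypothesis is what `fromℚ 0ℚ <ʳ x` unfolds to for the witness `ε`, whence the summand `0ℚ`.
≤⇒∥∥≮ : ∀ {x ε} → Eventually (λ n → 0ℚ ℚ.+ ε ℚ.≤ ℝ.seq x n) → ¬ ℝ.∥ x ∥< ε
≤⇒∥∥≮ {x} {ε} (N , ε≤x) (ℝ.bounded δ δ<ε (L , ∣x∣<δ)) = ℚₚ.<-irrefl ≡.refl (begin-strict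
  ε                        ≡⟨ ℚₚ.+-identityˡ ε ⟨
  0ℚ ℚ.+ ε                 ≤⟨ ε≤x M (ℕₚ.m≤m⊔n N L) ⟩
  ℝ.seq x M                ≤⟨ p≤∣p∣ (ℝ.seq x M) ⟩
  ℚ.∣ ℝ.seq x M ∣          <⟨ ∣x∣<δ M (ℕₚ.m≤n⊔m N L) ⟩
  δ                        <⟨ δ<ε ⟩
  ε                        ∎)
  where
  open ℚₚ.≤-Reasoning
  M : ℕ
  M = N ℕ.⊔ L

module _ {d} {K : NumberField d} (v : AbsoluteValue K) where

  private
    module K = NumberField K
    module V = AbsoluteValue v
    module KR = CommutativeRing K.commutativeRing
    module C = CommutativeRing (SeminormedRing.commutativeRing (completionAt v))
    open CauchySequences (seminormed v) using (pointwise; isNull)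

  fromBase-homo : RingMorphisms.IsRingHomomorphism KR.rawRing C.rawRing (fromBase v)
  fromBase-homo = record
    { isSemiringHomomorphism = record
      { isNearSemiringHomomorphism = record
        { +-isMonoidHomomorphism = record
          { isMagmaHomomorphism = record
            { isRelHomomorphism = record { cong = λ eq → pointwise λ _ → eq }
            ; homo = λ _ _ → pointwise λ _ → KR.refl }
          ; ε-homo = pointwise λ _ → KR.refl }
        ; *-homo = λ _ _ → pointwise λ _ → KR.refl }
      ; 1#-homo = pointwise λ _ → KR.refl }
    ; -‿homo = λ _ → pointwise λ _ → KR.refl }

  ℚ⟶completion : IsℚAlgebra (SeminormedRing.commutativeRing (completionAt v)) (fromBase v ∘ K.ι)
  ℚ⟶completion = Composition.isRingHomomorphism C.trans K.isRingHomomorphism fromBase-homo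

  -- If 1 ≈ 0, the constant sequence 1 - 0 is null, so the absolute value of 1 is below every
  -- positive rational, against `positivity`.
  completion-nontrivial : Nontrivial (SeminormedRing.commutativeRing (completionAt v))
  completion-nontrivial 1≈0 = contradicts (V.positivity 1#0)
    where
    1-0≈1 : K.1# KR.- K.0# K.≈ K.1#
    1-0≈1 = KR.trans (KR.+-congˡ (GroupProperties.ε⁻¹≈ε KR.+-group)) (KR.+-identityʳ K.1#)
    1#0 : K.1# K.# K.0#
    1#0 = HeytingField.invertible⇒# K.underlyingField
      (K.1# , KR.trans (KR.*-identityˡ _) 1-0≈1 , KR.trans (KR.*-identityʳ _) 1-0≈1)
    contradicts : ¬ fromℚ 0ℚ ℝ.<ʳ V.∣ K.1# ∣ᵥ
    contradicts (ε , 0<ε , ε≤∣1∣) = ≤⇒∥∥≮ {V.∣ K.1# ∣ᵥ} ε≤∣1∣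
      (SeminormedRing.∣∣<-resp (seminormed v) 1-0≈1 (proj₂ (isNull 1≈0 ε 0<ε) _ ℕₚ.≤-refl))

-- Doubling in the adelic point group and in `𝓔 n`.

open RawTopologicalGroup using (Carrier)

Double : (G : RawTopologicalGroup) → Carrier G → Carrier G → Set
Double G x y = x ∙ x ↦ y
  where open RawTopologicalGroup G

-- The neutral element enters only as some `O` with O + O = O, so both hypotheses are phrased by the
-- graph and can be transported along an isomorphism.
adelic-half : ∀ {d} (K : NumberField d) (r : ℚ) → r ≢ 0ℚ →
  let G = adelicPointGroup K (E r over K) in
  ∀ T O → Double G T O → Double G O O → ∃[ S ] Double G S T
adelic-half K r r≢0 (T , T-compatible) (O , _) 2T 2O =
  ((λ v → half v (T v) (torsion v)) ,
   λ v w e → compatible v w e (T v) (T w) (torsion v) (torsion w) (T-compatible v w e)) ,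
  λ v → half+half v (T v) (torsion v)
  where
  open module Half v = HalfPoint r r≢0 (SeminormedRing.commutativeRing (completionAt {K = K} v))
                         (ℚ⟶completion v) (completion-nontrivial v)
  torsion : ∀ v → TwoTorsion v (T v)
  torsion v = twoTorsion v (T v) (2T v) (2O v)

  compatible : ∀ v w (e : v ∼ w) P Q p q → Corresponding K (E r over K) v w e P Q →
               Corresponding K (E r over K) v w e (half v P p) (half w Q q)
  compatible v w e 𝒪              𝒪                _ _ _       = tt
  compatible v w e (affine x _ _) (affine x′ _ _) _ _ (x≈x′ , _) =
    -- `halfX` and `halfY` are polynomials over ℚ in x alone, and `transfer` keeps the terms of a
    -- Cauchy sequence, so both commute with it term by term.
    C.trans (pointwise λ _ → K-refl) (halfX-cong w x≈x′) ,
    C.trans (pointwise λ _ → K-refl) (halfY-cong w x≈x′)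
    where
    module C = CommutativeRing (SeminormedRing.commutativeRing (completionAt w))
    open CauchySequences (seminormed w) using (pointwise)
    K-refl = CommutativeRing.refl (NumberField.commutativeRing K)

-- A `RawTopologicalGroup` carries no laws, and `to (from x)` is x only up to ≈; this congruence
-- allows one to be replaced by the other.
DoubleRespects≈ : RawTopologicalGroup → Set
DoubleRespects≈ G = ∀ x x′ y y′ → x ≈ x′ → y ≈ y′ → Double G x y → Double G x′ y′
  where open RawTopologicalGroup G

∏-double : ∀ {I} G → (∀ i → DoubleRespects≈ (G i)) → DoubleRespects≈ (∏ I G)
∏-double G resp x x′ y y′ p q m i = resp i (x i) (x′ i) (y i) (y′ i) (p i) (q i) (m i)

⊗-double : ∀ G H → DoubleRespects≈ G → DoubleRespects≈ H → DoubleRespects≈ (G ⊗ H)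
⊗-double G H resp resp′ (x , u) (x′ , u′) (y , w) (y′ , w′) (p , p′) (q , q′) (m , m′) =
  resp x x′ y y′ p q m , resp′ u u′ w w′ p′ q′ m′

subgroup-double : ∀ G P → DoubleRespects≈ G → DoubleRespects≈ (subgroup G P)
subgroup-double G P resp (x , _) (x′ , _) (y , _) (y′ , _) = resp x x′ y y′

ℤ/-double : ∀ m → DoubleRespects≈ (ℤ/ m)
ℤ/-double m a a′ b b′ p q 2a≡b =
  ≡.subst (+ m ℤ∣.∣_)
    (solve 4 (λ a a′ b b′ → ((a :+ a :- b) :+ (b :- b′)) :+ (:- ((a :- a′) :+ (a :- a′)))
                         := (a′ :+ a′) :- b′) ≡.refl a a′ b b′)
    (ℤ∣.∣m∣n⇒∣m+n (ℤ∣.∣m∣n⇒∣m+n 2a≡b q) (ℤ∣.∣m⇒∣-m (ℤ∣.∣m∣n⇒∣m+n p p)))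
  where open ℤ-Solver.+-*-Solver

-- The summands are changed one at a time, so that the integers are added by the
-- transitivity of ≈ and additivity of k ↦ fromℚ (k / 1) is not needed.
ℝ/ℤ-double : DoubleRespects≈ ℝ/ℤ
ℝ/ℤ-double x x′ y y′ p q 2x≡y =
  trans {x′ R.+ x′} {x R.+ x′} {y′} (+-congʳ x′ x x′ (sym {x} {x′} p))
    (trans {x R.+ x′} {x R.+ x} {y′} (+-congˡ x x′ x (sym {x} {x′} p))
      (trans {x R.+ x} {y} {y′} 2x≡y q))
  where
  module R = CommutativeRing ℝ.completionRing
  open RawTopologicalGroup ℝ/ℤ using (_≈_; setoid)
  open Setoid setoid using (sym; trans)

  cancelʳ : ∀ u u′ v → (u R.+ v) R.- (u′ R.+ v) R.≈ u R.- u′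
  cancelʳ u u′ v = R.trans (R.+-congˡ (GroupProperties.⁻¹-anti-homo-∙ R.+-group u′ v))
    (R.trans (R.+-assoc u v _) (R.+-congˡ (GroupProperties.\\-leftDividesˡ R.+-group v (R.- u′))))

  +-congʳ : ∀ u u′ v → u ≈ u′ → u R.+ v ≈ u′ R.+ v
  +-congʳ u u′ v (k , p) = k , R.trans (cancelʳ u u′ v) p

  +-congˡ : ∀ u v v′ → v ≈ v′ → u R.+ v ≈ u R.+ v′
  +-congˡ u v v′ (k , p) = k , R.trans (R.+-cong (R.+-comm u v) (R.-‿cong (R.+-comm u v′)))
    (R.trans (cancelʳ v v′ u) p)

𝓔-double : ∀ n → DoubleRespects≈ (𝓔 n)
𝓔-double n = ⊗-double (∏ (Fin n) λ _ → ℝ/ℤ) ((∏ (Fin n) λ _ → Ẑ) ⊗ ∏ℤ/)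
  (∏-double (λ _ → ℝ/ℤ) λ _ → ℝ/ℤ-double)
  (⊗-double (∏ (Fin n) λ _ → Ẑ) ∏ℤ/
    (∏-double (λ _ → Ẑ) λ _ → subgroup-double ∏ℤ/ _ ∏ℤ/-double)
    ∏ℤ/-double)
  where
  ∏ℤ/-double : DoubleRespects≈ ∏ℤ/
  ∏ℤ/-double = ∏-double (λ k → ℤ/ suc k) (λ k → ℤ/-double (suc k))

-- An element of order 2 in `𝓔 n` that is not a double.

fromTorsion : ∀ n → Carrier ∏ℤ/ → Carrier (𝓔 n)
fromTorsion n a = (λ _ → fromℚ 0ℚ) ,
                  (λ _ → (λ _ → + 0) , λ k l _ → Setoid.refl (RawTopologicalGroup.setoid (ℤ/ suc k)) {+ 0}) ,
                  a

fromTorsion-double : ∀ n a b → Double ∏ℤ/ a b → Double (𝓔 n) (fromTorsion n a) (fromTorsion n b)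
fromTorsion-double n a b 2a≡b =
  (λ _ → + 0 , ℝ.pointwise λ _ → ≡.refl) ,
  (λ _ k → Setoid.refl (RawTopologicalGroup.setoid (ℤ/ suc k)) {+ 0}) ,
  2a≡b

-- The factor ℤ/2ℤ has index 1.
δ : Carrier ∏ℤ/
δ 1 = + 1
δ _ = + 0

2δ≡0 : Double ∏ℤ/ δ (λ _ → + 0)
2δ≡0 0             = ℤ∣.divides (+ 0) ≡.refl
2δ≡0 1             = ℤ∣.divides (+ 1) ≡.refl
2δ≡0 (suc (suc k)) = ℤ∣.divides (+ 0) ≡.refl

1-not-double : ∀ a → ¬ Double (ℤ/ 2) a (+ 1)
1-not-double a 2∣2a-1 = contradiction (∣1⇒≡1 (ℤ∣.∣⇒∣ᵤ (ℤ∣.∣m+n∣m⇒∣n 2∣2a-1 2∣2a))) λ ()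
  where
  open ℤ-Solver.+-*-Solver
  2∣2a : + 2 ℤ∣.∣ a ℤ.+ a
  2∣2a = ℤ∣.divides a (solve 1 (λ a → a :+ a := a :* con (+ 2)) ≡.refl a)

theorem5p6 : (n : ℕ) (K : NumberField n) (r : ℚ) → r ≢ 0ℚ →
    ¬ (adelicPointGroup K (E r over K) ≅ 𝓔 n)
theorem5p6 n K r r≢0 iso = 1-not-double (proj₂ (proj₂ (to S)) 1) (proj₂ (proj₂ double-in-𝓔) 1)
  where
  G H : RawTopologicalGroup
  G = adelicPointGroup K (E r over K)
  H = 𝓔 n

  open _≅_ iso using (to; from; homo)
  open Inverse (_≅_.inverse iso) using (strictlyInverseˡ)
  open Setoid (RawTopologicalGroup.setoid H) using (refl; sym)

  o γ : Carrier H
  o = fromTorsion n λ _ → + 0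
  γ = fromTorsion n δ

  -- `homo` speaks only of values of `to`, so the relation is first moved to `to (from x)` and
  -- `to (from y)`.
  double-from : ∀ x y → Double H x y → Double G (from x) (from y)
  double-from x y p = Equivalence.from (homo (from x) (from x) (from y))
    (𝓔-double n x (to (from x)) y (to (from y))
      (sym {to (from x)} {x} (strictlyInverseˡ x)) (sym {to (from y)} {y} (strictlyInverseˡ y)) p)

  halved : ∃[ S ] Double G S (from γ)
  halved = adelic-half K r r≢0 (from γ) (from o)
    (double-from γ o (fromTorsion-double n δ (λ _ → + 0) 2δ≡0))
    -- `from o` is only shown to be its own double, which is what `adelic-half` asks of the neutral
    -- element.
    (double-from o o (fromTorsion-double n (λ _ → + 0) (λ _ → + 0) λ _ → ℤ∣.divides (+ 0) ≡.refl))

  S : Carrier G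
  S = proj₁ halved

  double-in-𝓔 : Double H (to S) γ
  double-in-𝓔 = 𝓔-double n (to S) (to S) (to (from γ)) γ (refl {to S}) (strictlyInverseˡ γ)
    (Equivalence.to (homo S S (from γ)) (proj₂ halved))
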